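{- There is a constant $c>0$ such that for every $n\ge 2$ and every undirected graph $G$ with $n$ vertices the following holds: if $\chi$ is the initial coloring of $G$ and $\chi_{\mathsf{WL}}^m$ denotes the result of $m$ applications of the $2$-dimensional Weisfeiler-Leman refinement to $\chi$, then there is some $m\le c\, n\log n$ with $\pi(\chi_{\mathsf{WL}}^{m})=\pi(\chi_{\mathsf{WL}}^{m+1})$. That is, the $2$-dimensional Weisfeiler-Leman algorithm stabilizes after $\mathcal{O}(n\log n)$ iterations on graphs with $n$ vertices.
   Context: For an undirected graph $G=(V,E)$, its initial coloring $\chi\colon V^2\to\{ -1,0,1\}$ is given by $\chi(v,v)=-1$, $\chi(u,v)=1$ if $u\ne v$ and $\{u,v\}\in E$, and $\chi(u,v)=0$ otherwise. For a coloring $\chi$ of $V^2$, the $2$-dimensional Weisfeiler-Leman refinement produces the coloring $\chi_{\mathsf{WL}}(u,v):=\{\!\{(\chi(u,w),\chi(w,v)) : w\in V\}\!\}$ (a multiset); iterating gives $\chi_{\mathsf{WL}}^{m+1}=(\chi_{\mathsf{WL}}^m)_{\mathsf{WL}}$, $\chi_{\mathsf{WL}}^0=\chi$. $\pi(\chi)$ denotes the partition of $V^2$ into color classes of $\chi$. -}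

module Defs where

open import Data.Nat using (ℕ; zero; suc)
open import Data.Bool using (Bool; true; false; if_then_else_)
open import Data.Integer using (ℤ; +_; -[1+_])
open import Data.Fin using (Fin; _≟_)
open import Data.Fin.Permutation using (Permutation′; _⟨$⟩ʳ_)
open import Data.Product using (Σ; _×_; _,_; ∃-syntax)
open import Relation.Nullary.Decidable using (does)
open import Relation.Binary.PropositionalEquality using (_≡_)
open import Function.Bundles using (_⇔_)

record Graph (n : ℕ) : Set where
  field
    adj       : Fin n → Fin n → Bool
    adj-sym   : ∀ u v → adj u v ≡ adj v u
    adj-irrefl : ∀ v → adj v v ≡ false
open Graph public

initColor : ∀ {n} → Graph n → Fin n → Fin n → ℤ
initColor G u v =
  if does (u ≟ v) then -[1+ 0 ]
  else (if adj G u v then + 1 else + 0)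

-- SameColor G m (u,v) (u',v') holds iff χ_WL^m(u,v) = χ_WL^m(u',v').
-- For m+1 this is literally equality of the multisets
-- {{ (χ^m(u,w), χ^m(w,v)) : w ∈ V }} and {{ (χ^m(u',w), χ^m(w,v')) : w ∈ V }},
-- i.e. a bijection σ of V matching the elements with equal colors.
SameColor : ∀ {n} → Graph n → ℕ → (Fin n × Fin n) → (Fin n × Fin n) → Set
SameColor G zero    (u , v) (u' , v') = initColor G u v ≡ initColor G u' v'
SameColor G (suc m) (u , v) (u' , v') =
  ∃[ σ ] (∀ w → SameColor G m (u , w) (u' , σ ⟨$⟩ʳ w)
              × SameColor G m (w , v) (σ ⟨$⟩ʳ w , v'))

SamePartition : ∀ {n} → Graph n → ℕ → Set
SamePartition {n} G m = ∀ (p q : Fin n × Fin n) →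
  SameColor G m p q ⇔ SameColor G (suc m) p q

{-# OPTIONS --safe #-}
module Submission where

-- Let S m be the space of rational matrices that are constant on the colour classes after m rounds.
-- Equal colours after m + 1 rounds give S m · S m ⊆ S (m + 1), so products of 2^k matrices of S m lie in
-- S (m + k).  Products of at most n² matrices span the algebra A m generated by S m, hence
-- A m ⊆ S (m + K) ⊆ A (m + K) when n² ≤ 2^K.  If A m = A (m + K), then S (m + K) is closed under
-- multiplication, which means that the colouring is stable after m + K rounds.
--
-- It remains to bound the length of a chain of transposition-closed algebras A ⊊ B ⊊ … of n × n matrices.
-- The largest number of nonzero orthogonal projections in A summing to 1 grows weakly with A, the same
-- number for the commutant of A decreases weakly, and both lie between 0 and n.  They cannot both stay
-- the same when A grows strictly, so at most 2n strict inclusions occur.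
--
-- Maxima over infinite sets only exist up to double negation; this suffices, as SamePartition is decidable.

open import Defs
import Data.Nat as ℕ
import Data.Nat.Properties as ℕₚ
open import Data.Product using (proj₁; proj₂)

module _ where
  open import Data.Nat using (ℕ; zero; suc; z≤n; s≤s)
  open import Data.Bool using (true; false; if_then_else_)
  open import Data.Fin using (Fin; zero; suc; punchIn; combine; remQuot)
  open import Data.Fin.Permutation as Perm using (Permutation′; _⟨$⟩ʳ_; _⟨$⟩ˡ_)
  open import Data.Fin.Properties
    using (all?; any?; ¬∀⟶∃¬; remQuot-combine; punchInᵢ≢i; suc-injective) renaming (_≟_ to _≟ᶠ_)
  open import Data.Integer.Properties using () renaming (_≟_ to _≟ᶻ_)
  open import Data.List using (List; []; _∷_; _++_; length; take; drop; foldr)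
  open import Data.List.Properties using (length-++; take++drop≡id; length-take; length-drop)
  open import Data.List.Relation.Unary.All as All using (All; []; _∷_)
  import Data.List.Relation.Unary.All.Properties as Allₚ
  open import Data.Product using (Σ-syntax; _×_; _,_; ∃-syntax; uncurry)
  open import Data.Rational using (ℚ; 0ℚ; 1ℚ; _+_; _*_; _-_; -_; _≤_; 1/_; ≢-nonZero; nonNegative)
  open import Data.Rational.Properties
  open import Data.Rational.Solver using (module +-*-Solver)
  open import Data.Sum using (inj₁; inj₂)
  open import Data.Unit using (⊤; tt)
  open import Data.Vec.Functional using (insertAt)
  open import Data.Vec.Functional.Properties using (insertAt-lookup; insertAt-punchIn)
  open import Function using (_∘_)
  open import Function.Bundles using (mk⇔; Equivalence)
  open import Level using (0ℓ)
  open import Relation.Binary using (Rel; IsEquivalence; Decidable; Setoid)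
  open import Relation.Binary.PropositionalEquality
    using (_≡_; _≢_; refl; sym; trans; cong; cong₂; subst; module ≡-Reasoning)
  open import Relation.Nullary using (¬_; Dec; yes; no; contradiction)
  open import Relation.Nullary.Decidable
    using (does; decidable-stable; map′; ¬¬-excluded-middle; _×-dec_; _→-dec_)
  open import Algebra.Bundles using (CommutativeRing)
  open import Algebra.Properties.Group +-0-group using () renaming (∙-cancelˡ to +-cancelˡ)
  open import Algebra.Properties.Semiring.Sum (CommutativeRing.semiring +-*-commutativeRing)
    using (sum; sum-cong-≗; sum-remove; sum-permute; ∑-comm; ∑-distrib-+; *-distribˡ-sum; *-distribʳ-sum; sum-replicate-zero)
  open +-*-Solver using (solve; _:=_; _:+_; _:*_; _:-_; :-_; con)

  -- Double negation and bounded maxima.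

  infixl 1 _>>=_

  _>>=_ : {A B : Set} → ¬ ¬ A → (A → ¬ ¬ B) → ¬ ¬ B
  (m >>= f) k = m λ a → f a k

  return : {A : Set} → A → ¬ ¬ A
  return a k = k a

  Greatest : (ℕ → Set) → ℕ → Set
  Greatest P r = P r × (∀ s → P s → s ℕ.≤ r)

  -- Move to a larger witness as long as there is one. The fuel `d` satisfies `N ≤ r + d`, so when
  -- it runs out the current witness has reached the bound. Whether a larger witness exists is
  -- decided only under double negation.
  greatest : ∀ (P : ℕ → Set) N → (∀ r → P r → r ℕ.≤ N) → ∀ r → P r → ¬ ¬ (∃[ s ] Greatest P s)
  greatest P N bound r₀ Pr₀ = go (N ℕ.∸ r₀) r₀ Pr₀ (ℕₚ.m≤n+m∸n N r₀)
    where
    go : ∀ d r → P r → N ℕ.≤ r ℕ.+ d → ¬ ¬ (∃[ s ] Greatest P s)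
    go zero r Pr N≤ = return (r , Pr , λ s Ps →
      ℕₚ.≤-trans (bound s Ps) (subst (N ℕ.≤_) (ℕₚ.+-identityʳ r) N≤))
    go (suc d) r Pr N≤ = ¬¬-excluded-middle {A = ∃[ s ] P s × r ℕ.< s} >>= λ where
      (yes (s , Ps , r<s)) → go d s Ps (ℕₚ.≤-trans N≤
        (subst (ℕ._≤ s ℕ.+ d) (sym (ℕₚ.+-suc r d)) (ℕₚ.+-monoˡ-≤ d r<s)))
      (no none) → return (r , Pr , λ s Ps → ℕₚ.≮⇒≥ λ r<s → none (s , Ps , r<s))

  private variable
    k n p q r s : ℕ

  -- Finite sums, positivity and linear dependence over the rationals.

  sum-zero : (f : Fin n → ℚ) → (∀ i → f i ≡ 0ℚ) → sum f ≡ 0ℚ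
  sum-zero {n} f f≡0 = trans (sum-cong-≗ f≡0) (sum-replicate-zero n)

  sum-single : (f : Fin n → ℚ) (i : Fin n) → (∀ j → j ≢ i → f j ≡ 0ℚ) → sum f ≡ f i
  sum-single {suc n} f i f≡0 =
    trans (sum-remove {i = i} f)
          (trans (cong (f i +_) (sum-zero _ λ j → f≡0 (punchIn i j) (punchInᵢ≢i i j)))
                 (+-identityʳ (f i)))

  δ : Fin n → Fin n → ℚ
  δ zero    zero    = 1ℚ
  δ zero    (suc j) = 0ℚ
  δ (suc i) zero    = 0ℚ
  δ (suc i) (suc j) = δ i j

  δ-refl : (i : Fin n) → δ i i ≡ 1ℚ
  δ-refl zero    = refl
  δ-refl (suc i) = δ-refl i

  δ-≢ : (i j : Fin n) → i ≢ j → δ i j ≡ 0ℚ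
  δ-≢ zero    zero    i≢j = contradiction refl i≢j
  δ-≢ zero    (suc j) i≢j = refl
  δ-≢ (suc i) zero    i≢j = refl
  δ-≢ (suc i) (suc j) i≢j = δ-≢ i j (i≢j ∘ cong suc)

  δ-sym : (i j : Fin n) → δ i j ≡ δ j i
  δ-sym zero    zero    = refl
  δ-sym zero    (suc j) = refl
  δ-sym (suc i) zero    = refl
  δ-sym (suc i) (suc j) = δ-sym i j

  sum-δˡ : (f : Fin n → ℚ) (i : Fin n) → sum (λ j → δ i j * f j) ≡ f i
  sum-δˡ f i =
    trans (sum-single _ i λ j j≢i → trans (cong (_* f j) (δ-≢ i j (j≢i ∘ sym))) (*-zeroˡ (f j)))
          (trans (cong (_* f i) (δ-refl i)) (*-identityˡ (f i)))

  0≤x*x : ∀ x → 0ℚ ≤ x * x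
  0≤x*x x with ≤-total 0ℚ x
  ... | inj₁ 0≤x = subst (_≤ x * x) (*-zeroˡ x) (*-monoʳ-≤-nonNeg x ⦃ nonNegative 0≤x ⦄ 0≤x)
  ... | inj₂ x≤0 = subst (0ℚ ≤_) (solve 1 (λ x → (:- x) :* (:- x) := x :* x) refl x)
      (subst (_≤ (- x) * (- x)) (*-zeroˡ (- x)) (*-monoʳ-≤-nonNeg (- x) ⦃ nonNegative 0≤-x ⦄ 0≤-x))
    where
    0≤-x : 0ℚ ≤ - x
    0≤-x = neg-antimono-≤ x≤0

  recip : ∀ x → x ≢ 0ℚ → ∃[ y ] y * x ≡ 1ℚ
  recip x x≢0 = (1/ x) ⦃ ≢-nonZero x≢0 ⦄ , *-inverseˡ x ⦃ ≢-nonZero x≢0 ⦄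

  x*y≡0⇒y≡0 : ∀ x y → x ≢ 0ℚ → x * y ≡ 0ℚ → y ≡ 0ℚ
  x*y≡0⇒y≡0 x y x≢0 xy≡0 with z , zx≡1 ← recip x x≢0 = begin
    y            ≡⟨ *-identityˡ y ⟨
    1ℚ * y       ≡⟨ cong (_* y) zx≡1 ⟨
    z * x * y    ≡⟨ *-assoc z x y ⟩
    z * (x * y)  ≡⟨ cong (z *_) xy≡0 ⟩
    z * 0ℚ       ≡⟨ *-zeroʳ z ⟩
    0ℚ           ∎
    where open ≡-Reasoning

  x*x≡0⇒x≡0 : ∀ x → x * x ≡ 0ℚ → x ≡ 0ℚ
  x*x≡0⇒x≡0 x xx≡0 with x ≟ 0ℚ
  ... | yes x≡0 = x≡0
  ... | no  x≢0 = x*y≡0⇒y≡0 x x x≢0 xx≡0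

  0≤x+y≡0⇒x≡0 : ∀ x y → 0ℚ ≤ x → 0ℚ ≤ y → x + y ≡ 0ℚ → x ≡ 0ℚ
  0≤x+y≡0⇒x≡0 x y 0≤x 0≤y x+y≡0 = ≤-antisym
    (subst (x ≤_) x+y≡0 (subst (_≤ x + y) (+-identityʳ x) (+-monoʳ-≤ x 0≤y))) 0≤x

  0≤sum : (f : Fin n → ℚ) → (∀ i → 0ℚ ≤ f i) → 0ℚ ≤ sum f
  0≤sum {zero}  f 0≤f = ≤-refl
  0≤sum {suc n} f 0≤f = +-mono-≤ (0≤f zero) (0≤sum (f ∘ suc) (0≤f ∘ suc))

  sum≡0⇒≡0 : (f : Fin n → ℚ) → (∀ i → 0ℚ ≤ f i) → sum f ≡ 0ℚ → ∀ i → f i ≡ 0ℚ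
  sum≡0⇒≡0 f 0≤f Σ≡0 zero    = 0≤x+y≡0⇒x≡0 _ _ (0≤f zero) (0≤sum (f ∘ suc) (0≤f ∘ suc)) Σ≡0
  sum≡0⇒≡0 f 0≤f Σ≡0 (suc i) = sum≡0⇒≡0 (f ∘ suc) (0≤f ∘ suc)
    (0≤x+y≡0⇒x≡0 _ _ (0≤sum (f ∘ suc) (0≤f ∘ suc)) (0≤f zero) (trans (+-comm _ (f zero)) Σ≡0)) i

  -- Gaussian elimination; multiplying by the pivot avoids division.
  dependent : ∀ N k → N ℕ.< k → (u : Fin k → Fin N → ℚ) →
    Σ[ c ∈ (Fin k → ℚ) ] (∃[ i ] c i ≢ 0ℚ) × (∀ j → sum (λ i → c i * u i j) ≡ 0ℚ)
  dependent zero    (suc k) _         u = (λ _ → 1ℚ) , (zero , λ ()) , λ ()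
  dependent (suc N) (suc k) (s≤s N<k) u with all? (λ i → u i zero ≟ 0ℚ)
  ... | yes u≡0 with c , nz , rel ← dependent N (suc k) (ℕₚ.m<n⇒m<1+n N<k) (λ i j → u i (suc j))
      = c , nz , λ where
          zero    → sum-zero _ λ i → trans (cong (c i *_) (u≡0 i)) (*-zeroʳ (c i))
          (suc j) → rel j
  ... | no  u≢0 with i , a≢0 ← ¬∀⟶∃¬ (suc k) _ (λ i → u i zero ≟ 0ℚ) u≢0
      = c′ , (punchIn i (proj₁ (proj₁ (proj₂ ih))) , c′≢0) , rel
    where
    a = u i zero
    v : Fin k → Fin (suc N) → ℚ
    v j = u (punchIn i j)
    ih = dependent N k N<k (λ j l → a * v j (suc l) - v j zero * u i (suc l))
    -- Expanding a relation among those combinations puts the coefficient `a * c j` on `v j` and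
    -- collects `c₀` on the pivot row.
    c d : Fin k → ℚ
    c = proj₁ ih
    d j = a * c j
    c₀ = - sum (λ j → c j * v j zero)
    c′ = insertAt d i c₀

    c′≢0 : c′ (punchIn i (proj₁ (proj₁ (proj₂ ih)))) ≢ 0ℚ
    c′≢0 c′≡0 with j , cj≢0 ← proj₁ (proj₂ ih) =
      cj≢0 (x*y≡0⇒y≡0 a (c j) a≢0 (trans (sym (insertAt-punchIn d i c₀ j)) c′≡0))

    open ≡-Reasoning

    expand : ∀ l → sum (λ m → c′ m * u m l) ≡ sum (λ j → c j * (a * v j l - v j zero * u i l))
    expand l = begin
      sum (λ m → c′ m * u m l)
        ≡⟨ sum-remove {i = i} (λ m → c′ m * u m l) ⟩
      c′ i * u i l + sum (λ j → c′ (punchIn i j) * v j l)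
        ≡⟨ cong₂ _+_ (cong (_* u i l) (insertAt-lookup d i c₀))
                     (sum-cong-≗ λ j → cong (_* v j l) (insertAt-punchIn d i c₀ j)) ⟩
      c₀ * u i l + sum (λ j → d j * v j l)
        ≡⟨ cong (_+ sum (λ j → d j * v j l))
             (solve 2 (λ s x → :- s :* x := (:- x) :* s) refl (sum (λ j → c j * v j zero)) (u i l)) ⟩
      (- u i l) * sum (λ j → c j * v j zero) + sum (λ j → d j * v j l)
        ≡⟨ cong (_+ sum (λ j → d j * v j l)) (*-distribˡ-sum (- u i l) (λ j → c j * v j zero)) ⟩
      sum (λ j → (- u i l) * (c j * v j zero)) + sum (λ j → d j * v j l)
        ≡⟨ ∑-distrib-+ (λ j → (- u i l) * (c j * v j zero)) (λ j → d j * v j l) ⟨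
      sum (λ j → (- u i l) * (c j * v j zero) + d j * v j l)
        ≡⟨ sum-cong-≗ (λ j → solve 5 (λ a c b x y →
             (:- x) :* (c :* b) :+ (a :* c) :* y := c :* (a :* y :- b :* x)) refl
             a (c j) (v j zero) (u i l) (v j l)) ⟩
      sum (λ j → c j * (a * v j l - v j zero * u i l)) ∎

    rel : ∀ l → sum (λ m → c′ m * u m l) ≡ 0ℚ
    rel zero    = trans (expand zero) (sum-zero _ λ j →
      solve 3 (λ a c b → c :* (a :* b :- b :* a) := con 0ℚ) refl a (c j) (v j zero))
    rel (suc l) = trans (expand (suc l)) (proj₂ (proj₂ ih) l)

  -- Matrix arithmetic and the trace inner product.

  Mat : ℕ → ℕ → Set
  Mat p q = Fin p → Fin q → ℚ

  infix  4 _≈_ _≉_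
  infixl 6 _⊕_ _⊖_
  infixr 7 _•_
  infixl 7 _·_
  infix  8 _ᵀ

  -- A record and not a function type, so that both matrices can be recovered by unification.
  record _≈_ (M N : Mat p q) : Set where
    constructor mk≈
    field at : ∀ i j → M i j ≡ N i j
  open _≈_ public

  _≉_ : Mat p q → Mat p q → Set
  M ≉ N = ¬ M ≈ N

  𝟘 : Mat p q
  𝟘 _ _ = 0ℚ

  𝟙 : Mat n n
  𝟙 = δ

  -- Opaque, so that the operands can be inferred from equations between matrices.
  opaque
    _⊕_ _⊖_ : Mat p q → Mat p q → Mat p q
    (M ⊕ N) i j = M i j + N i j
    (M ⊖ N) i j = M i j - N i j

    _•_ : ℚ → Mat p q → Mat p q
    (c • M) i j = c * M i j

    _·_ : Mat p q → Mat q r → Mat p r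
    (M · N) i j = sum (λ k → M i k * N k j)

    _ᵀ : Mat p q → Mat q p
    (M ᵀ) i j = M j i

    ∑ : (Fin k → Mat p q) → Mat p q
    ∑ M i j = sum (λ l → M l i j)

    -- Vectors are one-column matrices, so the laws of `_·_` also cover the action on vectors.
    col : Mat p q → Fin q → Mat p 1
    col M j i _ = M i j

    -- This is the trace of `X ᵀ · Y`.
    ⟨_,_⟩ : Mat p q → Mat p q → ℚ
    ⟨ X , Y ⟩ = sum (λ i → sum (λ j → X i j * Y i j))

  matSetoid : ℕ → ℕ → Setoid _ _
  matSetoid p q = record
    { Carrier = Mat p q
    ; _≈_ = _≈_
    ; isEquivalence = record
      { refl  = mk≈ λ _ _ → refl
      ; sym   = λ e → mk≈ λ i j → sym (at e i j)
      ; trans = λ e f → mk≈ λ i j → trans (at e i j) (at f i j)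
      }
    }

  module _ {p q : ℕ} where
    open Setoid (matSetoid p q) public using () renaming (refl to ≈-refl; sym to ≈-sym; trans to ≈-trans)

  module ≈-Reasoning {p q : ℕ} where
    open import Relation.Binary.Reasoning.Setoid (matSetoid p q) public

  ≈𝟘? : (M : Mat p q) → Dec (M ≈ 𝟘)
  ≈𝟘? M = map′ mk≈ at (all? λ i → all? λ j → M i j ≟ 0ℚ)

  nonzero-entry : (M : Mat p q) → M ≉ 𝟘 → ∃[ i ] ∃[ j ] M i j ≢ 0ℚ
  nonzero-entry {p} {q} M M≉0 with i , row ← ¬∀⟶∃¬ p _ (λ i → all? λ j → M i j ≟ 0ℚ) (M≉0 ∘ mk≈)
    = i , ¬∀⟶∃¬ q _ (λ j → M i j ≟ 0ℚ) row

  opaque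
    unfolding _⊕_

    ⊕-cong : {M M′ N N′ : Mat p q} → M ≈ M′ → N ≈ N′ → M ⊕ N ≈ M′ ⊕ N′
    ⊕-cong e f = mk≈ λ i j → cong₂ _+_ (at e i j) (at f i j)

    ⊖-cong : {M M′ N N′ : Mat p q} → M ≈ M′ → N ≈ N′ → M ⊖ N ≈ M′ ⊖ N′
    ⊖-cong e f = mk≈ λ i j → cong₂ _-_ (at e i j) (at f i j)

    •-cong : (c : ℚ) {M N : Mat p q} → M ≈ N → c • M ≈ c • N
    •-cong c e = mk≈ λ i j → cong (c *_) (at e i j)

    ·-cong : {M M′ : Mat p q} {N N′ : Mat q r} → M ≈ M′ → N ≈ N′ → M · N ≈ M′ · N′
    ·-cong e f = mk≈ λ i j → sum-cong-≗ λ k → cong₂ _*_ (at e i k) (at f k j)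

  ·-congˡ : {M : Mat p q} {N N′ : Mat q r} → N ≈ N′ → M · N ≈ M · N′
  ·-congˡ = ·-cong ≈-refl

  ·-congʳ : {M M′ : Mat p q} {N : Mat q r} → M ≈ M′ → M · N ≈ M′ · N
  ·-congʳ e = ·-cong e ≈-refl

  opaque
    unfolding _⊕_

    ᵀ-cong : {M N : Mat p q} → M ≈ N → M ᵀ ≈ N ᵀ
    ᵀ-cong e = mk≈ λ i j → at e j i

    ᵀ-involutive : (M : Mat p q) → M ᵀ ᵀ ≈ M
    ᵀ-involutive M = ≈-refl

    ·-ᵀ : (M : Mat p q) (N : Mat q r) → (M · N) ᵀ ≈ N ᵀ · M ᵀ
    ·-ᵀ M N = mk≈ λ i j → sum-cong-≗ λ k → *-comm (M j k) (N k i)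

    𝟙-ᵀ : 𝟙 {n} ᵀ ≈ 𝟙
    𝟙-ᵀ = mk≈ λ i j → δ-sym j i

    ·-assoc : (L : Mat p q) (M : Mat q r) (N : Mat r s) → L · M · N ≈ L · (M · N)
    ·-assoc L M N = mk≈ λ i j → begin
      sum (λ l → sum (λ k → L i k * M k l) * N l j)
        ≡⟨ sum-cong-≗ (λ l → *-distribʳ-sum (N l j) (λ k → L i k * M k l)) ⟩
      sum (λ l → sum (λ k → L i k * M k l * N l j))
        ≡⟨ ∑-comm (λ l k → L i k * M k l * N l j) ⟩
      sum (λ k → sum (λ l → L i k * M k l * N l j))
        ≡⟨ sum-cong-≗ (λ k → sum-cong-≗ λ l → *-assoc (L i k) (M k l) (N l j)) ⟩
      sum (λ k → sum (λ l → L i k * (M k l * N l j)))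
        ≡⟨ sum-cong-≗ (λ k → *-distribˡ-sum (L i k) (λ l → M k l * N l j)) ⟨
      sum (λ k → L i k * sum (λ l → M k l * N l j)) ∎
      where open ≡-Reasoning

    𝟙-· : (M : Mat p q) → 𝟙 · M ≈ M
    𝟙-· M = mk≈ λ i j → sum-δˡ (λ k → M k j) i

    ·-𝟙 : (M : Mat p q) → M · 𝟙 ≈ M
    ·-𝟙 M = mk≈ λ i j → trans
      (sum-cong-≗ λ k → trans (*-comm (M i k) (δ k j)) (cong (_* M i k) (δ-sym k j)))
      (sum-δˡ (M i) j)

    𝟘-· : (M : Mat q r) → 𝟘 {p} · M ≈ 𝟘
    𝟘-· M = mk≈ λ i j → sum-zero _ λ k → *-zeroˡ (M k j)

    ·-𝟘 : (M : Mat p q) → M · 𝟘 {q} {r} ≈ 𝟘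
    ·-𝟘 M = mk≈ λ i j → sum-zero _ λ k → *-zeroʳ (M i k)

    •-· : (c : ℚ) (M : Mat p q) (N : Mat q r) → (c • M) · N ≈ c • (M · N)
    •-· c M N = mk≈ λ i j → trans (sum-cong-≗ λ k → *-assoc c (M i k) (N k j))
                                  (sym (*-distribˡ-sum c (λ k → M i k * N k j)))

    ·-• : (c : ℚ) (M : Mat p q) (N : Mat q r) → M · (c • N) ≈ c • (M · N)
    ·-• c M N = mk≈ λ i j → trans
      (sum-cong-≗ λ k → solve 3 (λ c m n → m :* (c :* n) := c :* (m :* n)) refl c (M i k) (N k j))
      (sym (*-distribˡ-sum c (λ k → M i k * N k j)))

    ·-distribʳ-⊕ : (L : Mat q r) (M N : Mat p q) → (M ⊕ N) · L ≈ M · L ⊕ N · L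
    ·-distribʳ-⊕ L M N = mk≈ λ i j → trans
      (sum-cong-≗ λ k → *-distribʳ-+ (L k j) (M i k) (N i k))
      (∑-distrib-+ (λ k → M i k * L k j) (λ k → N i k * L k j))

    ·-distribˡ-⊕ : (L : Mat p q) (M N : Mat q r) → L · (M ⊕ N) ≈ L · M ⊕ L · N
    ·-distribˡ-⊕ L M N = mk≈ λ i j → trans
      (sum-cong-≗ λ k → *-distribˡ-+ (L i k) (M k j) (N k j))
      (∑-distrib-+ (λ k → L i k * M k j) (λ k → L i k * N k j))

    ⊖-as-⊕ : (M N : Mat p q) → M ⊖ N ≈ M ⊕ (- 1ℚ) • N
    ⊖-as-⊕ M N = mk≈ λ i j → solve 2 (λ m n → m :- n := m :+ con (- 1ℚ) :* n) refl (M i j) (N i j)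

  ·-distribʳ-⊖ : (L : Mat q r) (M N : Mat p q) → (M ⊖ N) · L ≈ M · L ⊖ N · L
  ·-distribʳ-⊖ L M N = begin
    (M ⊖ N) · L                 ≈⟨ ·-congʳ (⊖-as-⊕ M N) ⟩
    (M ⊕ (- 1ℚ) • N) · L        ≈⟨ ·-distribʳ-⊕ L M _ ⟩
    M · L ⊕ ((- 1ℚ) • N) · L    ≈⟨ ⊕-cong ≈-refl (•-· (- 1ℚ) N L) ⟩
    M · L ⊕ (- 1ℚ) • (N · L)    ≈⟨ ⊖-as-⊕ (M · L) (N · L) ⟨
    M · L ⊖ N · L               ∎
    where open ≈-Reasoning

  ·-distribˡ-⊖ : (L : Mat p q) (M N : Mat q r) → L · (M ⊖ N) ≈ L · M ⊖ L · N
  ·-distribˡ-⊖ L M N = begin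
    L · (M ⊖ N)                 ≈⟨ ·-congˡ (⊖-as-⊕ M N) ⟩
    L · (M ⊕ (- 1ℚ) • N)        ≈⟨ ·-distribˡ-⊕ L M _ ⟩
    L · M ⊕ L · ((- 1ℚ) • N)    ≈⟨ ⊕-cong ≈-refl (·-• (- 1ℚ) L N) ⟩
    L · M ⊕ (- 1ℚ) • (L · N)    ≈⟨ ⊖-as-⊕ (L · M) (L · N) ⟨
    L · M ⊖ L · N               ∎
    where open ≈-Reasoning

  opaque
    unfolding _⊕_

    ≈⇒⊖≈𝟘 : {M N : Mat p q} → M ≈ N → M ⊖ N ≈ 𝟘
    ≈⇒⊖≈𝟘 {N = N} e = mk≈ λ i j → trans (cong (_- N i j) (at e i j)) (+-inverseʳ (N i j))

    ⊖≈𝟘⇒≈ : {M N : Mat p q} → M ⊖ N ≈ 𝟘 → M ≈ N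
    ⊖≈𝟘⇒≈ {M = M} {N} e = mk≈ λ i j → trans
      (solve 2 (λ m n → m := (m :- n) :+ n) refl (M i j) (N i j))
      (trans (cong (_+ N i j) (at e i j)) (+-identityˡ (N i j)))

    ∑-zero : {M : Fin 0 → Mat p q} → ∑ M ≈ 𝟘
    ∑-zero = mk≈ λ _ _ → refl

    ∑-suc : {M : Fin (suc k) → Mat p q} → ∑ M ≈ M zero ⊕ ∑ (M ∘ suc)
    ∑-suc = mk≈ λ _ _ → refl

    ∑-cong : {M N : Fin k → Mat p q} → (∀ l → M l ≈ N l) → ∑ M ≈ ∑ N
    ∑-cong e = mk≈ λ i j → sum-cong-≗ λ l → at (e l) i j

    ∑-· : (M : Fin k → Mat p q) (N : Mat q r) → ∑ M · N ≈ ∑ (λ l → M l · N)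
    ∑-· M N = mk≈ λ i j → trans
      (sum-cong-≗ λ m → *-distribʳ-sum (N m j) (λ l → M l i m))
      (∑-comm (λ m l → M l i m * N m j))

    ·-∑ : (N : Mat p q) (M : Fin k → Mat q r) → N · ∑ M ≈ ∑ (λ l → N · M l)
    ·-∑ N M = mk≈ λ i j → trans
      (sum-cong-≗ λ m → *-distribˡ-sum (N i m) (λ l → M l m j))
      (∑-comm (λ m l → N i m * M l m j))

    col-· : (M : Mat p q) (N : Mat q r) (j : Fin r) → col (M · N) j ≈ M · col N j
    col-· M N j = mk≈ λ _ _ → refl

    col-cong : {M N : Mat p q} → M ≈ N → ∀ j → col M j ≈ col N j
    col-cong e j = mk≈ λ i _ → at e i j

    col-⊕ : (M N : Mat p q) (j : Fin q) → col (M ⊕ N) j ≈ col M j ⊕ col N j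
    col-⊕ M N j = ≈-refl

    col-• : (c : ℚ) (M : Mat p q) (j : Fin q) → col (c • M) j ≈ c • col M j
    col-• c M j = ≈-refl

    col-𝟘 : (j : Fin q) → col (𝟘 {p} {q}) j ≈ 𝟘
    col-𝟘 j = ≈-refl

    col-spread : (w : Mat p 1) (j : Fin q) → col (λ i _ → w i zero) j ≈ w
    col-spread w j = mk≈ λ { i zero → refl }

    col-entry : (M : Mat p q) (j : Fin q) (i : Fin p) → col M j i zero ≡ M i j
    col-entry M j i = refl

    ≈-by-col : {M N : Mat p q} → (∀ j → col M j ≈ col N j) → M ≈ N
    ≈-by-col e = mk≈ λ i j → at (e j) i zero

    ·-as-∑ : (M : Mat p q) (v : Mat q 1) → M · v ≈ ∑ (λ k → v k zero • col M k)
    ·-as-∑ M v = mk≈ λ { i zero → sum-cong-≗ λ k → *-comm (M i k) (v k zero) }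

    nonzero-col : (M : Mat p q) → M ≉ 𝟘 → ∃[ j ] col M j ≉ 𝟘
    nonzero-col M M≉𝟘 with i , j , Mij≢0 ← nonzero-entry M M≉𝟘 = j , λ e → Mij≢0 (at e i zero)

    ⟨col,col⟩ : (M : Mat p q) (N : Mat p r) (j : Fin q) (l : Fin r) → ⟨ col M j , col N l ⟩ ≡ (M ᵀ · N) j l
    ⟨col,col⟩ M N j l = sum-cong-≗ λ i → +-identityʳ (M i j * N i l)

    ∑-δ• : (i : Fin k) (M : Mat p q) → ∑ (λ j → δ i j • M) ≈ M
    ∑-δ• i M = mk≈ λ a b → sum-δˡ (λ _ → M a b) i

    ∑-⊕ : (M N : Fin k → Mat p q) → ∑ (λ l → M l ⊕ N l) ≈ ∑ M ⊕ ∑ N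
    ∑-⊕ M N = mk≈ λ i j → ∑-distrib-+ (λ l → M l i j) (λ l → N l i j)

    ⊖-⊕-cancel : (M N : Mat p q) → (M ⊖ N) ⊕ N ≈ M
    ⊖-⊕-cancel M N = mk≈ λ i j → solve 2 (λ m n → (m :- n) :+ n := m) refl (M i j) (N i j)

    ⊕-comm : (M N : Mat p q) → M ⊕ N ≈ N ⊕ M
    ⊕-comm M N = mk≈ λ i j → +-comm (M i j) (N i j)

    ⊖-𝟘 : (M : Mat p q) → M ⊖ 𝟘 ≈ M
    ⊖-𝟘 M = mk≈ λ i j → solve 1 (λ m → m :- con 0ℚ := m) refl (M i j)

    1•≈ : {c : ℚ} → c ≡ 1ℚ → (M : Mat p q) → c • M ≈ M
    1•≈ refl M = mk≈ λ i j → *-identityˡ (M i j)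

    0•≈ : {c : ℚ} → c ≡ 0ℚ → (M : Mat p q) → c • M ≈ 𝟘
    0•≈ refl M = mk≈ λ i j → *-zeroˡ (M i j)

    ᵀ-⊖ : (M N : Mat p q) → (M ⊖ N) ᵀ ≈ M ᵀ ⊖ N ᵀ
    ᵀ-⊖ M N = ≈-refl

    ᵀ-⊕ : (M N : Mat p q) → (M ⊕ N) ᵀ ≈ M ᵀ ⊕ N ᵀ
    ᵀ-⊕ M N = ≈-refl

    ᵀ-• : (c : ℚ) (M : Mat p q) → (c • M) ᵀ ≈ c • M ᵀ
    ᵀ-• c M = ≈-refl

    ᵀ-𝟘 : 𝟘 {p} {q} ᵀ ≈ 𝟘
    ᵀ-𝟘 = ≈-refl

    ⊕-𝟘 : 𝟘 {p} {q} ⊕ 𝟘 ≈ 𝟘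
    ⊕-𝟘 = mk≈ λ _ _ → refl

    ⟨⟩-congˡ : {X X′ : Mat p q} (Y : Mat p q) → X ≈ X′ → ⟨ X , Y ⟩ ≡ ⟨ X′ , Y ⟩
    ⟨⟩-congˡ Y e = sum-cong-≗ λ i → sum-cong-≗ λ j → cong (_* Y i j) (at e i j)

    ⟨⟩-comm : (X Y : Mat p q) → ⟨ X , Y ⟩ ≡ ⟨ Y , X ⟩
    ⟨⟩-comm X Y = sum-cong-≗ λ i → sum-cong-≗ λ j → *-comm (X i j) (Y i j)

    ⟨⟩-𝟘 : (X : Mat p q) → ⟨ 𝟘 , X ⟩ ≡ 0ℚ
    ⟨⟩-𝟘 X = sum-zero _ λ i → sum-zero _ λ j → *-zeroˡ (X i j)

    ⟨⟩-⊕ : (X Y Z : Mat p q) → ⟨ X ⊕ Y , Z ⟩ ≡ ⟨ X , Z ⟩ + ⟨ Y , Z ⟩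
    ⟨⟩-⊕ X Y Z = trans
      (sum-cong-≗ λ i → trans (sum-cong-≗ λ j → *-distribʳ-+ (Z i j) (X i j) (Y i j))
                              (∑-distrib-+ (λ j → X i j * Z i j) (λ j → Y i j * Z i j)))
      (∑-distrib-+ (λ i → sum (λ j → X i j * Z i j)) (λ i → sum (λ j → Y i j * Z i j)))

    ⟨⟩-• : (c : ℚ) (X Y : Mat p q) → ⟨ c • X , Y ⟩ ≡ c * ⟨ X , Y ⟩
    ⟨⟩-• c X Y = trans
      (sum-cong-≗ λ i → trans (sum-cong-≗ λ j → *-assoc c (X i j) (Y i j))
                              (sym (*-distribˡ-sum c (λ j → X i j * Y i j))))
      (sym (*-distribˡ-sum c (λ i → sum (λ j → X i j * Y i j))))

  ⟨⟩-⊖ : (X Y Z : Mat p q) → ⟨ X ⊖ Y , Z ⟩ ≡ ⟨ X , Z ⟩ - ⟨ Y , Z ⟩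
  ⟨⟩-⊖ X Y Z = begin
    ⟨ X ⊖ Y , Z ⟩                   ≡⟨ ⟨⟩-congˡ Z (⊖-as-⊕ X Y) ⟩
    ⟨ X ⊕ (- 1ℚ) • Y , Z ⟩          ≡⟨ ⟨⟩-⊕ X _ Z ⟩
    ⟨ X , Z ⟩ + ⟨ (- 1ℚ) • Y , Z ⟩  ≡⟨ cong (⟨ X , Z ⟩ +_) (⟨⟩-• (- 1ℚ) Y Z) ⟩
    ⟨ X , Z ⟩ + - 1ℚ * ⟨ Y , Z ⟩    ≡⟨ solve 2 (λ x y → x :- y := x :+ con (- 1ℚ) :* y) refl ⟨ X , Z ⟩ ⟨ Y , Z ⟩ ⟨
    ⟨ X , Z ⟩ - ⟨ Y , Z ⟩           ∎
    where open ≡-Reasoning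

  opaque
    unfolding _⊕_

    -- A sum of rational squares vanishes only if each square does.
    ⟨⟩-definite : (X : Mat p q) → ⟨ X , X ⟩ ≡ 0ℚ → X ≈ 𝟘
    ⟨⟩-definite X X·X≡0 = mk≈ λ i j → x*x≡0⇒x≡0 (X i j)
      (sum≡0⇒≡0 _ (λ j → 0≤x*x (X i j))
        (sum≡0⇒≡0 _ (λ i → 0≤sum _ λ j → 0≤x*x (X i j)) X·X≡0 i) j)

    ⟨⟩-adjoint : (X : Mat p r) (M : Mat p q) (Y : Mat q r) → ⟨ X , M · Y ⟩ ≡ ⟨ M ᵀ · X , Y ⟩
    ⟨⟩-adjoint X M Y = begin
      sum (λ i → sum (λ j → X i j * sum (λ k → M i k * Y k j)))
        ≡⟨ sum-cong-≗ (λ i → sum-cong-≗ λ j → *-distribˡ-sum (X i j) (λ k → M i k * Y k j)) ⟩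
      sum (λ i → sum (λ j → sum (λ k → X i j * (M i k * Y k j))))
        ≡⟨ sum-cong-≗ (λ i → ∑-comm (λ j k → X i j * (M i k * Y k j))) ⟩
      sum (λ i → sum (λ k → sum (λ j → X i j * (M i k * Y k j))))
        ≡⟨ ∑-comm (λ i k → sum (λ j → X i j * (M i k * Y k j))) ⟩
      sum (λ k → sum (λ i → sum (λ j → X i j * (M i k * Y k j))))
        ≡⟨ sum-cong-≗ (λ k → ∑-comm (λ i j → X i j * (M i k * Y k j))) ⟩
      sum (λ k → sum (λ j → sum (λ i → X i j * (M i k * Y k j))))
        ≡⟨ sum-cong-≗ (λ k → sum-cong-≗ λ j → sum-cong-≗ λ i →
             solve 3 (λ x m y → x :* (m :* y) := m :* x :* y) refl (X i j) (M i k) (Y k j)) ⟩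
      sum (λ k → sum (λ j → sum (λ i → M i k * X i j * Y k j)))
        ≡⟨ sum-cong-≗ (λ k → sum-cong-≗ λ j → *-distribʳ-sum (Y k j) (λ i → M i k * X i j)) ⟨
      sum (λ k → sum (λ j → sum (λ i → M i k * X i j) * Y k j)) ∎
      where open ≡-Reasoning

  -- Orthogonal families and projections onto subspaces.

  record OrthogonalFamily (W : Mat p q → Set) (k : ℕ) : Set where
    field
      vec        : Fin k → Mat p q
      member     : ∀ i → W (vec i)
      -- Nonzero and not of norm 1: normalising would require square roots.
      nonzero    : ∀ i → vec i ≉ 𝟘
      orthogonal : ∀ i j → i ≢ j → ⟨ vec i , vec j ⟩ ≡ 0ℚ
  open OrthogonalFamily

  opaque
    unfolding _⊕_

    ⟨⟩-∑ : (M : Fin k → Mat p q) (X : Mat p q) → ⟨ ∑ M , X ⟩ ≡ sum (λ l → ⟨ M l , X ⟩)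
    ⟨⟩-∑ {zero}  M X = sum-zero (λ i → sum (λ j → 0ℚ * X i j)) λ i → sum-zero (λ j → 0ℚ * X i j) λ j → *-zeroˡ (X i j)
    ⟨⟩-∑ {suc k} M X = trans (⟨⟩-⊕ (M zero) (∑ (M ∘ suc)) X)
                             (cong (⟨ M zero , X ⟩ +_) (⟨⟩-∑ (M ∘ suc) X))

    -- More than `p * q` matrices satisfy a nontrivial linear relation. Pairing it with a member
    -- whose coefficient is nonzero makes that member have norm zero.
    orthogonal-bound : {W : Mat p q → Set} → OrthogonalFamily W k → k ℕ.≤ p ℕ.* q
    orthogonal-bound {p} {q} {k} F with k ℕₚ.≤? p ℕ.* q
    ... | yes k≤pq = k≤pq
    ... | no  k≰pq with c , (m , cm≢0) , rel ← dependent (p ℕ.* q) k (ℕₚ.≰⇒> k≰pq)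
                                               (λ l → uncurry (vec F l) ∘ remQuot q)
        = contradiction (⟨⟩-definite (vec F m) (x*y≡0⇒y≡0 (c m) _ cm≢0 (begin
            c m * ⟨ vec F m , vec F m ⟩              ≡⟨ sum-single _ m (λ l l≢m →
                                                          trans (cong (c l *_) (orthogonal F l m l≢m)) (*-zeroʳ (c l))) ⟨
            sum (λ l → c l * ⟨ vec F l , vec F m ⟩)  ≡⟨ sum-cong-≗ (λ l → ⟨⟩-• (c l) (vec F l) (vec F m)) ⟨
            sum (λ l → ⟨ c l • vec F l , vec F m ⟩)  ≡⟨ ⟨⟩-∑ (λ l → c l • vec F l) (vec F m) ⟨
            ⟨ ∑ (λ l → c l • vec F l) , vec F m ⟩    ≡⟨ ⟨⟩-congˡ (vec F m) (mk≈ λ i j →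
                                                          subst (λ ij → sum (λ l → c l * uncurry (vec F l) ij) ≡ 0ℚ)
                                                                (remQuot-combine {p} {q} i j) (rel (combine i j))) ⟩
            ⟨ 𝟘 , vec F m ⟩                          ≡⟨ ⟨⟩-𝟘 (vec F m) ⟩
            0ℚ                                       ∎)))
          (nonzero F m)
      where open ≡-Reasoning

  record Subspace (W : Mat p q → Set) : Set where
    field
      resp    : ∀ {M N} → M ≈ N → W M → W N
      zero∈   : W 𝟘
      ⊕-closed : ∀ {M N} → W M → W N → W (M ⊕ N)
      •-closed : ∀ c {M} → W M → W (c • M)

    ⊖-closed : ∀ {M N} → W M → W N → W (M ⊖ N)
    ⊖-closed {M} {N} m n = resp (≈-sym (⊖-as-⊕ M N)) (⊕-closed m (•-closed (- 1ℚ) n))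

    ∑-closed : (M : Fin k → Mat p q) → (∀ i → W (M i)) → W (∑ M)
    ∑-closed {zero}  M m = resp (≈-sym ∑-zero) zero∈
    ∑-closed {suc k} M m = resp (≈-sym ∑-suc) (⊕-closed (m zero) (∑-closed (M ∘ suc) (m ∘ suc)))

  module _ {W : Mat p q → Set} (S : Subspace W) where
    open Subspace S

    -- The last component expresses that `e` lies in the span of `F` without naming coefficients:
    -- `e` is orthogonal to whatever is orthogonal to all of `F`.
    gram-schmidt : (F : OrthogonalFamily W k) → ∀ z →
      ∃[ e ] W e × (∀ j → ⟨ z ⊖ e , vec F j ⟩ ≡ 0ℚ)
                 × (∀ y → (∀ j → ⟨ y , vec F j ⟩ ≡ 0ℚ) → ⟨ y , e ⟩ ≡ 0ℚ)
    gram-schmidt {zero}  F z = 𝟘 , zero∈ , (λ ()) , λ y _ → trans (⟨⟩-comm y 𝟘) (⟨⟩-𝟘 y)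
    gram-schmidt {suc k} F z
      with e , We , z⊖e⟂ , ⟂e ← gram-schmidt {k} (record
             { vec = vec F ∘ suc
             ; member = member F ∘ suc
             ; nonzero = nonzero F ∘ suc
             ; orthogonal = λ i j i≢j → orthogonal F (suc i) (suc j) (i≢j ∘ suc-injective)
             }) z
      with y , y*uu≡1 ← recip ⟨ vec F zero , vec F zero ⟩ (nonzero F zero ∘ ⟨⟩-definite (vec F zero))
      = e ⊕ c • u , ⊕-closed We (•-closed c (member F zero)) , residual , in-span
      where
      open ≡-Reasoning
      -- Since `y` inverts `⟨ u , u ⟩`, the number `c` is the usual coefficient of the remaining
      -- residual along `u`.
      u = vec F zero
      c = ⟨ z ⊖ e , u ⟩ * y
      expand : ∀ x → ⟨ z ⊖ (e ⊕ c • u) , x ⟩ ≡ ⟨ z ⊖ e , x ⟩ - c * ⟨ u , x ⟩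
      expand x = begin
        ⟨ z ⊖ (e ⊕ c • u) , x ⟩                  ≡⟨ ⟨⟩-⊖ z (e ⊕ c • u) x ⟩
        ⟨ z , x ⟩ - ⟨ e ⊕ c • u , x ⟩            ≡⟨ cong (λ s → ⟨ z , x ⟩ - s) (trans (⟨⟩-⊕ e (c • u) x) (cong (⟨ e , x ⟩ +_) (⟨⟩-• c u x))) ⟩
        ⟨ z , x ⟩ - (⟨ e , x ⟩ + c * ⟨ u , x ⟩)  ≡⟨ solve 3 (λ a b d → a :- (b :+ d) := (a :- b) :- d) refl ⟨ z , x ⟩ ⟨ e , x ⟩ (c * ⟨ u , x ⟩) ⟩
        ⟨ z , x ⟩ - ⟨ e , x ⟩ - c * ⟨ u , x ⟩    ≡⟨ cong (_- c * ⟨ u , x ⟩) (⟨⟩-⊖ z e x) ⟨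
        ⟨ z ⊖ e , x ⟩ - c * ⟨ u , x ⟩            ∎
      residual : ∀ j → ⟨ z ⊖ (e ⊕ c • u) , vec F j ⟩ ≡ 0ℚ
      residual zero = begin
        ⟨ z ⊖ (e ⊕ c • u) , u ⟩            ≡⟨ expand u ⟩
        t - t * y * ⟨ u , u ⟩              ≡⟨ cong (λ s → t - s) (trans (*-assoc t y ⟨ u , u ⟩) (trans (cong (t *_) y*uu≡1) (*-identityʳ t))) ⟩
        t - t                              ≡⟨ +-inverseʳ t ⟩
        0ℚ                                 ∎
        where t = ⟨ z ⊖ e , u ⟩
      residual (suc j) = begin
        ⟨ z ⊖ (e ⊕ c • u) , vec F (suc j) ⟩                     ≡⟨ expand (vec F (suc j)) ⟩
        ⟨ z ⊖ e , vec F (suc j) ⟩ - c * ⟨ u , vec F (suc j) ⟩   ≡⟨ cong₂ (λ a b → a - c * b) (z⊖e⟂ j) (orthogonal F zero (suc j) λ ()) ⟩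
        0ℚ - c * 0ℚ                                             ≡⟨ solve 1 (λ c → con 0ℚ :- c :* con 0ℚ := con 0ℚ) refl c ⟩
        0ℚ                                                      ∎
      in-span : ∀ x → (∀ j → ⟨ x , vec F j ⟩ ≡ 0ℚ) → ⟨ x , e ⊕ c • u ⟩ ≡ 0ℚ
      in-span x x⟂ = begin
        ⟨ x , e ⊕ c • u ⟩          ≡⟨ ⟨⟩-comm x (e ⊕ c • u) ⟩
        ⟨ e ⊕ c • u , x ⟩          ≡⟨ trans (⟨⟩-⊕ e (c • u) x) (cong (⟨ e , x ⟩ +_) (⟨⟩-• c u x)) ⟩
        ⟨ e , x ⟩ + c * ⟨ u , x ⟩  ≡⟨ cong₂ (λ a b → a + c * b) (trans (⟨⟩-comm e x) (⟂e x (x⟂ ∘ suc))) (trans (⟨⟩-comm u x) (x⟂ zero)) ⟩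
        0ℚ + c * 0ℚ                ≡⟨ solve 1 (λ c → con 0ℚ :+ c :* con 0ℚ := con 0ℚ) refl c ⟩
        0ℚ                         ∎

    extend : (F : OrthogonalFamily W k) → ∀ x → W x → x ≉ 𝟘 → (∀ j → ⟨ x , vec F j ⟩ ≡ 0ℚ) →
      OrthogonalFamily W (suc k)
    extend F x Wx x≉𝟘 x⟂ = record
      { vec        = λ { zero → x ; (suc i) → vec F i }
      ; member     = λ { zero → Wx ; (suc i) → member F i }
      ; nonzero    = λ { zero → x≉𝟘 ; (suc i) → nonzero F i }
      ; orthogonal = λ where
          zero    zero    0≢0 → contradiction refl 0≢0
          zero    (suc j) _   → x⟂ j
          (suc i) zero    _   → trans (⟨⟩-comm (vec F i) x) (x⟂ i)
          (suc i) (suc j) i≢j → orthogonal F i j (i≢j ∘ cong suc)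
      }

    -- Project onto an orthogonal family in `W` of maximal length. If some `x` in `W` differed from
    -- its own projection `x₀`, the residual would extend the family; hence `W` adds nothing to the
    -- span and `z ⊖ e` is orthogonal to all of it. The maximal length is what requires the double
    -- negation.
    orthogonal-projection : ∀ z → ¬ ¬ (∃[ e ] W e × (∀ x → W x → ⟨ z ⊖ e , x ⟩ ≡ 0ℚ))
    orthogonal-projection z =
      greatest (OrthogonalFamily W) (p ℕ.* q) (λ _ → orthogonal-bound) 0
        (record { vec = λ () ; member = λ () ; nonzero = λ () ; orthogonal = λ () }) >>= λ where
      (k , F , F-max) → let e , We , z⊖e⟂ , _ = gram-schmidt F z in
        return (e , We , λ x Wx →
          let x₀ , Wx₀ , x⊖x₀⟂ , ⟂x₀ = gram-schmidt F x
              x≈x₀ = ⊖≈𝟘⇒≈ (decidable-stable (≈𝟘? (x ⊖ x₀)) λ x⊖x₀≉𝟘 →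
                       ℕₚ.1+n≰n (F-max (suc k) (extend F (x ⊖ x₀) (⊖-closed Wx Wx₀) x⊖x₀≉𝟘 x⊖x₀⟂)))
          in trans (⟨⟩-comm (z ⊖ e) x) (trans (⟨⟩-congˡ (z ⊖ e) x≈x₀)
               (trans (⟨⟩-comm x₀ (z ⊖ e)) (⟂x₀ (z ⊖ e) z⊖e⟂))))

  ∑-𝟘 : (M : Fin k → Mat p q) → (∀ l → M l ≈ 𝟘) → ∑ M ≈ 𝟘
  ∑-𝟘 {zero}  M e = ∑-zero
  ∑-𝟘 {suc k} M e = ≈-trans ∑-suc (≈-trans (⊕-cong (e zero) (∑-𝟘 (M ∘ suc) (e ∘ suc))) ⊕-𝟘)

  ¬¬-∀ : {P : Fin k → Set} → (∀ i → ¬ ¬ P i) → ¬ ¬ (∀ i → P i)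
  ¬¬-∀ {zero}  p = return λ ()
  ¬¬-∀ {suc k} p = p zero >>= λ p₀ → ¬¬-∀ (p ∘ suc) >>= λ pₛ →
    return λ { zero → p₀ ; (suc i) → pₛ i }

  -- Transposition-closed algebras and their projections.

  record StarAlgebra (A : Mat n n → Set) : Set where
    field
      subspace : Subspace A
      𝟙∈       : A 𝟙
      ·-closed : ∀ {M N} → A M → A N → A (M · N)
      ᵀ-closed : ∀ {M} → A M → A (M ᵀ)
    open Subspace subspace public

  record Projection (e : Mat n n) : Set where
    field
      symmetric  : e ᵀ ≈ e
      idempotent : e · e ≈ e
  open Projection

  Projection-resp : {e f : Mat n n} → e ≈ f → Projection e → Projection f
  Projection-resp e≈f P = record
    { symmetric  = ≈-trans (ᵀ-cong (≈-sym e≈f)) (≈-trans (symmetric P) e≈f)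
    ; idempotent = ≈-trans (·-cong (≈-sym e≈f) (≈-sym e≈f)) (≈-trans (idempotent P) e≈f)
    }

  -- The orthogonal projection q of 𝟙 onto W works: for M ∈ W and D = Mᵀ (𝟙 − q),
  -- orthogonality of 𝟙 − q to M D ∈ W says ⟨ D , D ⟩ = 0.
  ideal-generator : {C W : Mat n n → Set} → StarAlgebra C → Subspace W → (∀ {M} → W M → C M) →
    (∀ {M N} → W M → C N → W (M · N)) →
    ¬ ¬ (∃[ q ] W q × Projection q × (∀ {M} → W M → q · M ≈ M))
  ideal-generator {n} {C} {W} C* W-sub W⊆C WC⊆W = orthogonal-projection W-sub 𝟙 >>= λ (q , Wq , 𝟙⊖q⟂) →
      let open ≈-Reasoning
          Mᵀ≈Mᵀq : ∀ {M} → W M → M ᵀ ≈ M ᵀ · q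
          Mᵀ≈Mᵀq {M} WM = ⊖≈𝟘⇒≈ (begin
            M ᵀ ⊖ M ᵀ · q        ≈⟨ ⊖-cong (·-𝟙 (M ᵀ)) ≈-refl ⟨
            M ᵀ · 𝟙 ⊖ M ᵀ · q    ≈⟨ ·-distribˡ-⊖ (M ᵀ) 𝟙 q ⟨
            M ᵀ · (𝟙 ⊖ q)        ≈⟨ ⟨⟩-definite _ (trans
                                      (sym (⟨⟩-adjoint (𝟙 ⊖ q) M (M ᵀ · (𝟙 ⊖ q))))
                                      (𝟙⊖q⟂ _ (WC⊆W WM (·-closed (ᵀ-closed (W⊆C WM)) (⊖-closed 𝟙∈ (W⊆C Wq)))))) ⟩
            𝟘                    ∎)
          qᵀ≈q : q ᵀ ≈ q
          qᵀ≈q = begin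
            q ᵀ          ≈⟨ Mᵀ≈Mᵀq Wq ⟩
            q ᵀ · q      ≈⟨ ·-congˡ (ᵀ-involutive q) ⟨
            q ᵀ · q ᵀ ᵀ  ≈⟨ ·-ᵀ (q ᵀ) q ⟨
            (q ᵀ · q) ᵀ  ≈⟨ ᵀ-cong (Mᵀ≈Mᵀq Wq) ⟨
            q ᵀ ᵀ        ≈⟨ ᵀ-involutive q ⟩
            q            ∎
      in return (q , Wq
        , record { symmetric = qᵀ≈q
                 ; idempotent = begin
                     q · q    ≈⟨ ·-congʳ qᵀ≈q ⟨
                     q ᵀ · q  ≈⟨ Mᵀ≈Mᵀq Wq ⟨
                     q ᵀ      ≈⟨ qᵀ≈q ⟩
                     q        ∎ }
        , λ {M} WM → begin
            q · M          ≈⟨ ·-cong qᵀ≈q (ᵀ-involutive M) ⟨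
            q ᵀ · M ᵀ ᵀ    ≈⟨ ·-ᵀ (M ᵀ) q ⟨
            (M ᵀ · q) ᵀ    ≈⟨ ᵀ-cong (Mᵀ≈Mᵀq WM) ⟨
            M ᵀ ᵀ          ≈⟨ ᵀ-involutive M ⟩
            M              ∎)
    where open StarAlgebra C*

  -- Transposition reverses the product and fixes all three matrices.
  Projection-·-comm : {e f g : Mat n n} → Projection e → Projection f → g ᵀ ≈ g → e · f ≈ g → f · e ≈ g
  Projection-·-comm {e = e} {f} {g} E F gᵀ≈g ef≈g = begin
    f · e        ≈⟨ ·-cong (symmetric F) (symmetric E) ⟨
    f ᵀ · e ᵀ    ≈⟨ ·-ᵀ e f ⟨
    (e · f) ᵀ    ≈⟨ ᵀ-cong ef≈g ⟩
    g ᵀ          ≈⟨ gᵀ≈g ⟩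
    g            ∎
    where open ≈-Reasoning

  -- Decompositions of the identity into orthogonal projections.

  record Decomposition (A : Mat n n → Set) (r : ℕ) : Set where
    field
      part       : Fin r → Mat n n
      part∈      : ∀ i → A (part i)
      projection : ∀ i → Projection (part i)
      part≉𝟘     : ∀ i → part i ≉ 𝟘
      disjoint   : ∀ i j → i ≢ j → part i · part j ≈ 𝟘
      complete   : ∑ part ≈ 𝟙
  open Decomposition

  Decomposition-mono : {A B : Mat n n → Set} → (∀ {M} → A M → B M) → Decomposition A r → Decomposition B r
  Decomposition-mono A⊆B D = record
    { part = part D ; part∈ = A⊆B ∘ part∈ D ; projection = projection D
    ; part≉𝟘 = part≉𝟘 D ; disjoint = disjoint D ; complete = complete D }

  -- Pick a nonzero column from every part. The inner product of columns of two parts is an entry of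
  -- their product, which is zero, so these columns are `r` orthogonal vectors in dimension `n`.
  decomposition-bound : {A : Mat n n → Set} → Decomposition A r → r ℕ.≤ n
  decomposition-bound {n} {r} D = subst (r ℕ.≤_) (ℕₚ.*-identityʳ n) (orthogonal-bound {W = λ _ → ⊤} record
    { vec        = λ i → col (part D i) (proj₁ (c i))
    ; member     = λ _ → tt
    ; nonzero    = λ i → proj₂ (c i)
    ; orthogonal = λ i j i≢j → trans (⟨col,col⟩ (part D i) (part D j) _ _)
        (at (≈-trans (·-congʳ (symmetric (projection D i))) (disjoint D i j i≢j)) _ _)
    })
    where
    c : ∀ i → ∃[ j ] col (part D i) j ≉ 𝟘
    c i = nonzero-col (part D i) (part≉𝟘 D i)

  trivial-decomposition : {A : Mat (suc n) (suc n) → Set} → StarAlgebra A → Decomposition A 1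
  trivial-decomposition A* = record
    { part       = λ _ → 𝟙
    ; part∈      = λ _ → 𝟙∈
    ; projection = λ _ → record { symmetric = 𝟙-ᵀ ; idempotent = 𝟙-· 𝟙 }
    ; part≉𝟘     = λ _ 𝟙≈𝟘 → 1≢0 (at 𝟙≈𝟘 zero zero)
    ; disjoint   = λ { zero zero 0≢0 → contradiction refl 0≢0 }
    ; complete   = ≈-trans ∑-suc (≈-trans (⊕-cong ≈-refl ∑-zero) ⊕-identityʳ′)
    }
    where
    open StarAlgebra A*
    ⊕-identityʳ′ : 𝟙 ⊕ 𝟘 ≈ 𝟙
    ⊕-identityʳ′ = ≈-trans (⊕-cong (≈-sym (⊖-𝟘 𝟙)) ≈-refl) (⊖-⊕-cancel 𝟙 𝟘)

  -- The part `d` is replaced by the two projections `e` and `d ⊖ e`.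
  split : {A : Mat n n → Set} → StarAlgebra A → (D : Decomposition A r) (i : Fin r) {e : Mat n n} →
    A e → Projection e → part D i · e ≈ e → e ≉ 𝟘 → part D i ⊖ e ≉ 𝟘 → Decomposition A (suc r)
  split {n} {r} {A} A* D i {e} Ae E de≈e e≉𝟘 d⊖e≉𝟘 = record
    { part       = new
    ; part∈      = λ { zero → Ae ; (suc j) → ⊖-closed (part∈ D j) (•-closed (δ i j) Ae) }
    ; projection = λ { zero → E ; (suc j) → rest-projection j }
    ; part≉𝟘     = λ { zero → e≉𝟘 ; (suc j) → rest≉𝟘 j }
    ; disjoint   = λ where
        zero    zero    0≢0 → contradiction refl 0≢0
        zero    (suc k) _   → e·rest k
        (suc j) zero    _   → Projection-·-comm E (rest-projection j) ᵀ-𝟘 (e·rest j)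
        (suc j) (suc k) j≢k → rest-disjoint j k (j≢k ∘ cong suc)
    ; complete   = begin
        ∑ new                           ≈⟨ ∑-suc ⟩
        e ⊕ ∑ rest                      ≈⟨ ⊕-comm e (∑ rest) ⟩
        ∑ rest ⊕ e                      ≈⟨ ⊕-cong ≈-refl (∑-δ• i e) ⟨
        ∑ rest ⊕ ∑ (λ j → δ i j • e)    ≈⟨ ∑-⊕ rest (λ j → δ i j • e) ⟨
        ∑ (λ j → rest j ⊕ δ i j • e)    ≈⟨ ∑-cong (λ j → ⊖-⊕-cancel (part D j) (δ i j • e)) ⟩
        ∑ (part D)                      ≈⟨ complete D ⟩
        𝟙                               ∎
    }
    where
    open StarAlgebra A*
    open ≈-Reasoning
    d = part D i
    -- The factor `δ i j` subtracts `e` from part `i` alone, so that one formula covers all parts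
    -- and their sum is immediate.
    rest : Fin r → Mat n n
    rest j = part D j ⊖ δ i j • e
    new : Fin (suc r) → Mat n n
    new zero    = e
    new (suc j) = rest j

    rest-here : rest i ≈ d ⊖ e
    rest-here = ⊖-cong ≈-refl (1•≈ (δ-refl i) e)
    rest-there : ∀ j → i ≢ j → rest j ≈ part D j
    rest-there j i≢j = ≈-trans (⊖-cong ≈-refl (0•≈ (δ-≢ i j i≢j) e)) (⊖-𝟘 (part D j))

    ed≈e : e · d ≈ e
    ed≈e = Projection-·-comm (projection D i) E (symmetric E) de≈e
    e·rest : ∀ j → e · rest j ≈ 𝟘
    e·rest j with i ≟ᶠ j
    ... | yes refl = begin
      e · rest i       ≈⟨ ·-congˡ rest-here ⟩
      e · (d ⊖ e)      ≈⟨ ·-distribˡ-⊖ e d e ⟩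
      e · d ⊖ e · e    ≈⟨ ≈⇒⊖≈𝟘 (≈-trans ed≈e (≈-sym (idempotent E))) ⟩
      𝟘                ∎
    ... | no i≢j = begin
      e · rest j           ≈⟨ ·-cong (≈-sym ed≈e) (rest-there j i≢j) ⟩
      e · d · part D j     ≈⟨ ·-assoc e d (part D j) ⟩
      e · (d · part D j)   ≈⟨ ·-congˡ (disjoint D i j i≢j) ⟩
      e · 𝟘                ≈⟨ ·-𝟘 e ⟩
      𝟘                    ∎
    d⊖e : Projection (d ⊖ e)
    d⊖e = record
      { symmetric  = ≈-trans (ᵀ-⊖ d e) (⊖-cong (symmetric (projection D i)) (symmetric E))
      ; idempotent = begin
          (d ⊖ e) · (d ⊖ e)              ≈⟨ ·-distribʳ-⊖ (d ⊖ e) d e ⟩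
          d · (d ⊖ e) ⊖ e · (d ⊖ e)      ≈⟨ ⊖-cong (·-distribˡ-⊖ d d e) (≈-trans (·-congˡ (≈-sym rest-here)) (e·rest i)) ⟩
          (d · d ⊖ d · e) ⊖ 𝟘            ≈⟨ ⊖-𝟘 _ ⟩
          d · d ⊖ d · e                  ≈⟨ ⊖-cong (idempotent (projection D i)) de≈e ⟩
          d ⊖ e                          ∎
      }
    rest-projection : ∀ j → Projection (rest j)
    rest-projection j with i ≟ᶠ j
    ... | yes refl = Projection-resp (≈-sym rest-here) d⊖e
    ... | no  i≢j  = Projection-resp (≈-sym (rest-there j i≢j)) (projection D j)
    rest≉𝟘 : ∀ j → rest j ≉ 𝟘
    rest≉𝟘 j with i ≟ᶠ j
    ... | yes refl = λ r≈𝟘 → d⊖e≉𝟘 (≈-trans (≈-sym rest-here) r≈𝟘)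
    ... | no  i≢j  = λ r≈𝟘 → part≉𝟘 D j (≈-trans (≈-sym (rest-there j i≢j)) r≈𝟘)
    rest-here-disjoint : ∀ k → i ≢ k → rest i · rest k ≈ 𝟘
    rest-here-disjoint k i≢k = begin
      rest i · rest k                ≈⟨ ·-congʳ rest-here ⟩
      (d ⊖ e) · rest k               ≈⟨ ·-distribʳ-⊖ (rest k) d e ⟩
      d · rest k ⊖ e · rest k        ≈⟨ ⊖-cong (·-congˡ (rest-there k i≢k)) (e·rest k) ⟩
      d · part D k ⊖ 𝟘               ≈⟨ ⊖-𝟘 _ ⟩
      d · part D k                   ≈⟨ disjoint D i k i≢k ⟩
      𝟘                              ∎
    rest-disjoint : ∀ j k → j ≢ k → rest j · rest k ≈ 𝟘
    rest-disjoint j k j≢k with i ≟ᶠ j | i ≟ᶠ k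
    ... | yes refl | _        = rest-here-disjoint k j≢k
    ... | no _     | yes refl = Projection-·-comm (rest-projection i) (rest-projection j) ᵀ-𝟘
                                  (rest-here-disjoint j (j≢k ∘ sym))
    ... | no i≢j   | no i≢k   = ≈-trans (·-cong (rest-there j i≢j) (rest-there k i≢k)) (disjoint D j k j≢k)

  -- Parts are minimal projections when no decomposition has one part more, since a proper nonzero
  -- subprojection would allow a split.
  finest-part : {A : Mat n n → Set} → StarAlgebra A → (D : Decomposition A r) → ¬ Decomposition A (suc r) →
    ∀ i {e} → A e → Projection e → part D i · e ≈ e → e ≉ 𝟘 → e ≈ part D i
  finest-part A* D finest i {e} Ae E de≈e e≉𝟘 = ≈-sym (⊖≈𝟘⇒≈ (decidable-stable (≈𝟘? (part D i ⊖ e))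
    λ d⊖e≉𝟘 → finest (split A* D i Ae E de≈e e≉𝟘 d⊖e≉𝟘)))

  -- Let `p` be the projection generating the right ideal `a B` with `a = d yᵀ`. It lies below `d`,
  -- and it kills `w` because `y` does. Minimality of `d` leaves `p = 0` or `p = d`, and the latter
  -- would give `w = d w = 0`. So `p = 0`, hence `a = p a = 0`, and `y d` is its transpose.
  injective-on-part : {B : Mat n n → Set} → StarAlgebra B → (D : Decomposition B r) → ¬ Decomposition B (suc r) →
    ∀ i {y} → B y → (w : Mat n q) → part D i · w ≈ w → w ≉ 𝟘 → y · w ≈ 𝟘 → ¬ ¬ (y · part D i ≈ 𝟘)
  injective-on-part {n} {B = B} B* D finest i {y} By w dw≈w w≉𝟘 yw≈𝟘 =
    ideal-generator B* W-subspace W⊆B WB⊆W >>= λ (p , (x , Bx , p≈ax) , P , p-generates) →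
    let dp≈p : d · p ≈ p
        dp≈p = begin
          d · p          ≈⟨ ·-congˡ p≈ax ⟩
          d · (a · x)    ≈⟨ ·-assoc d a x ⟨
          d · a · x      ≈⟨ ·-congʳ (≈-trans (≈-sym (·-assoc d d (y ᵀ))) (·-congʳ (idempotent (projection D i)))) ⟩
          a · x          ≈⟨ p≈ax ⟨
          p              ∎
        pw≈𝟘 : p · w ≈ 𝟘
        pw≈𝟘 = begin
          p · w                ≈⟨ ·-congʳ (≈-trans (≈-sym (symmetric P)) (≈-trans (ᵀ-cong p≈ax) (·-ᵀ a x))) ⟩
          x ᵀ · a ᵀ · w        ≈⟨ ·-congʳ (·-congˡ aᵀ≈yd) ⟩
          x ᵀ · (y · d) · w    ≈⟨ ·-assoc (x ᵀ) (y · d) w ⟩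
          x ᵀ · (y · d · w)    ≈⟨ ·-congˡ (≈-trans (·-assoc y d w) (≈-trans (·-congˡ dw≈w) yw≈𝟘)) ⟩
          x ᵀ · 𝟘              ≈⟨ ·-𝟘 (x ᵀ) ⟩
          𝟘                    ∎
        p≈𝟘 : p ≈ 𝟘
        p≈𝟘 = decidable-stable (≈𝟘? p) λ p≉𝟘 → w≉𝟘 (begin
          w        ≈⟨ dw≈w ⟨
          d · w    ≈⟨ ·-congʳ (finest-part B* D finest i (W⊆B (x , Bx , p≈ax)) P dp≈p p≉𝟘) ⟨
          p · w    ≈⟨ pw≈𝟘 ⟩
          𝟘        ∎)
    in return (begin
        y · d      ≈⟨ aᵀ≈yd ⟨
        a ᵀ        ≈⟨ ᵀ-cong (p-generates (𝟙 , 𝟙∈ , ≈-sym (·-𝟙 a))) ⟨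
        (p · a) ᵀ  ≈⟨ ᵀ-cong (≈-trans (·-congʳ p≈𝟘) (𝟘-· a)) ⟩
        𝟘 ᵀ        ≈⟨ ᵀ-𝟘 ⟩
        𝟘          ∎)
    where
    open StarAlgebra B*
    open ≈-Reasoning
    d = part D i
    a = d · y ᵀ
    Ba : B a
    Ba = ·-closed (part∈ D i) (ᵀ-closed By)
    aᵀ≈yd : a ᵀ ≈ y · d
    aᵀ≈yd = ≈-trans (·-ᵀ d (y ᵀ)) (·-cong (ᵀ-involutive y) (symmetric (projection D i)))
    W : Mat n n → Set
    W M = ∃[ x ] B x × M ≈ a · x
    W⊆B : ∀ {M} → W M → B M
    W⊆B (x , Bx , M≈ax) = resp (≈-sym M≈ax) (·-closed Ba Bx)
    WB⊆W : ∀ {M N} → W M → B N → W (M · N)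
    WB⊆W {N = N} (x , Bx , M≈ax) BN = x · N , ·-closed Bx BN , ≈-trans (·-congʳ M≈ax) (·-assoc a x N)
    W-subspace : Subspace W
    W-subspace = record
      { resp     = λ M≈N (x , Bx , M≈ax) → x , Bx , ≈-trans (≈-sym M≈N) M≈ax
      ; zero∈    = 𝟘 , zero∈ , ≈-sym (·-𝟘 a)
      ; ⊕-closed = λ (x , Bx , M≈ax) (z , Bz , N≈az) →
          x ⊕ z , ⊕-closed Bx Bz , ≈-trans (⊕-cong M≈ax N≈az) (≈-sym (·-distribˡ-⊕ a x z))
      ; •-closed = λ c (x , Bx , M≈ax) →
          c • x , •-closed c Bx , ≈-trans (•-cong c M≈ax) (≈-sym (·-• c a x))
      }

  -- Commutants and the comparison of two nested algebras.

  Commutant : (Mat n n → Set) → Mat n n → Set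
  Commutant A M = ∀ {a} → A a → M · a ≈ a · M

  commutant-algebra : {A : Mat n n → Set} → StarAlgebra A → StarAlgebra (Commutant A)
  commutant-algebra {A = A} A* = record
    { subspace = record
      { resp     = λ M≈N M′ Aa → ≈-trans (·-congʳ (≈-sym M≈N)) (≈-trans (M′ Aa) (·-congˡ M≈N))
      ; zero∈    = λ {a} _ → ≈-trans (𝟘-· a) (≈-sym (·-𝟘 a))
      ; ⊕-closed = λ {M} {N} M′ N′ {a} Aa → ≈-trans (·-distribʳ-⊕ a M N)
          (≈-trans (⊕-cong (M′ Aa) (N′ Aa)) (≈-sym (·-distribˡ-⊕ a M N)))
      ; •-closed = λ c {M} M′ {a} Aa → ≈-trans (•-· c M a) (≈-trans (•-cong c (M′ Aa)) (≈-sym (·-• c a M)))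
      }
    ; 𝟙∈       = λ {a} _ → ≈-trans (𝟙-· a) (≈-sym (·-𝟙 a))
    ; ·-closed = λ {M} {N} M′ N′ {a} Aa → begin
        M · N · a      ≈⟨ ·-assoc M N a ⟩
        M · (N · a)    ≈⟨ ·-congˡ (N′ Aa) ⟩
        M · (a · N)    ≈⟨ ·-assoc M a N ⟨
        M · a · N      ≈⟨ ·-congʳ (M′ Aa) ⟩
        a · M · N      ≈⟨ ·-assoc a M N ⟩
        a · (M · N)    ∎
    ; ᵀ-closed = λ {M} M′ {a} Aa → begin
        M ᵀ · a        ≈⟨ ·-congˡ (ᵀ-involutive a) ⟨
        M ᵀ · a ᵀ ᵀ    ≈⟨ ·-ᵀ (a ᵀ) M ⟨
        (a ᵀ · M) ᵀ    ≈⟨ ᵀ-cong (M′ (ᵀ-closed Aa)) ⟨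
        (M · a ᵀ) ᵀ    ≈⟨ ·-ᵀ M (a ᵀ) ⟩
        a ᵀ ᵀ · M ᵀ    ≈⟨ ·-congʳ (ᵀ-involutive a) ⟩
        a · M ᵀ        ∎
    }
    where
    open StarAlgebra A* using (ᵀ-closed)
    open ≈-Reasoning

  commutant-antitone : {A B : Mat n n → Set} → (∀ {M} → A M → B M) → ∀ {M} → Commutant B M → Commutant A M
  commutant-antitone A⊆B M′ Aa = M′ (A⊆B Aa)

  full-algebra : StarAlgebra {n} (λ _ → ⊤)
  full-algebra = record
    { subspace = record { resp = λ _ _ → tt ; zero∈ = tt ; ⊕-closed = λ _ _ → tt ; •-closed = λ _ _ → tt }
    ; 𝟙∈ = tt ; ·-closed = λ _ _ → tt ; ᵀ-closed = λ _ → tt }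

  -- The matrices with all columns in `A w` form a right ideal of the full matrix algebra, and its
  -- generator `q` projects onto `A w`. As `A w` is invariant under `A` and `A` is closed under
  -- transposition, `q` commutes with `A`. Moreover `q` lies below `d` and fixes `w`, so minimality
  -- of `d` in the commutant gives `q = d`. Then `z = q z` is a combination of columns of `q`, all
  -- of which lie in `A w`.
  cyclic-on-part : {A : Mat n n → Set} → StarAlgebra A →
    (D : Decomposition (Commutant A) r) → ¬ Decomposition (Commutant A) (suc r) →
    ∀ i (w z : Mat n 1) → part D i · w ≈ w → w ≉ 𝟘 → part D i · z ≈ z → ¬ ¬ (∃[ x ] A x × z ≈ x · w)
  cyclic-on-part {n} {A = A} A* D finest i w z dw≈w w≉𝟘 dz≈z =
    ideal-generator full-algebra W-subspace (λ _ → tt) W-right >>= λ (q , Wq , Q , q-generates) →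
    let qaq≈aq : ∀ {a} → A a → q · (a · q) ≈ a · q
        qaq≈aq {a} Aa = q-generates λ j → let x , Ax , e = Wq j in a · x , ·-closed Aa Ax ,
          ≈-trans (col-· a q j) (≈-trans (·-congˡ e) (≈-sym (·-assoc a x w)))
        q∈A′ : Commutant A q
        q∈A′ {a} Aa = begin
          q · a                ≈⟨ ·-cong (symmetric Q) (ᵀ-involutive a) ⟨
          q ᵀ · a ᵀ ᵀ          ≈⟨ ·-ᵀ (a ᵀ) q ⟨
          (a ᵀ · q) ᵀ          ≈⟨ ᵀ-cong (qaq≈aq (ᵀ-closed Aa)) ⟨
          (q · (a ᵀ · q)) ᵀ    ≈⟨ ·-ᵀ q (a ᵀ · q) ⟩
          (a ᵀ · q) ᵀ · q ᵀ    ≈⟨ ·-cong (·-ᵀ (a ᵀ) q) (symmetric Q) ⟩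
          q ᵀ · a ᵀ ᵀ · q      ≈⟨ ·-congʳ (·-cong (symmetric Q) (ᵀ-involutive a)) ⟩
          q · a · q            ≈⟨ ·-assoc q a q ⟩
          q · (a · q)          ≈⟨ qaq≈aq Aa ⟩
          a · q                ∎
        dq≈q : d · q ≈ q
        dq≈q = ≈-by-col λ j → let x , Ax , e = Wq j in begin
          col (d · q) j    ≈⟨ col-· d q j ⟩
          d · col q j      ≈⟨ ·-congˡ e ⟩
          d · (x · w)      ≈⟨ ·-assoc d x w ⟨
          d · x · w        ≈⟨ ·-congʳ (part∈ D i Ax) ⟩
          x · d · w        ≈⟨ ·-assoc x d w ⟩
          x · (d · w)      ≈⟨ ·-congˡ dw≈w ⟩
          x · w            ≈⟨ e ⟨
          col q j          ∎
        qw≈w : q · w ≈ w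
        qw≈w = let i₀ , _ = nonzero-entry w w≉𝟘 in begin
          q · w                    ≈⟨ ·-congˡ (spread-col i₀) ⟨
          q · col spread i₀        ≈⟨ col-· q spread i₀ ⟨
          col (q · spread) i₀      ≈⟨ col-cong (q-generates λ j → 𝟙 , 𝟙∈ , ≈-trans (spread-col j) (≈-sym (𝟙-· w))) i₀ ⟩
          col spread i₀            ≈⟨ spread-col i₀ ⟩
          w                        ∎
        q≉𝟘 : q ≉ 𝟘
        q≉𝟘 q≈𝟘 = w≉𝟘 (≈-trans (≈-sym qw≈w) (≈-trans (·-congʳ q≈𝟘) (𝟘-· w)))
        q≈d = finest-part (commutant-algebra A*) D finest i q∈A′ Q dq≈q q≉𝟘
        x = ∑ (λ k → z k zero • proj₁ (Wq k))
    in return (x , ∑-closed _ (λ k → •-closed (z k zero) (proj₁ (proj₂ (Wq k)))) , (begin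
        z                                          ≈⟨ dz≈z ⟨
        d · z                                      ≈⟨ ·-congʳ q≈d ⟨
        q · z                                      ≈⟨ ·-as-∑ q z ⟩
        ∑ (λ k → z k zero • col q k)               ≈⟨ ∑-cong (λ k → ≈-trans (•-cong (z k zero) (proj₂ (proj₂ (Wq k))))
                                                                            (≈-sym (•-· (z k zero) (proj₁ (Wq k)) w))) ⟩
        ∑ (λ k → (z k zero • proj₁ (Wq k)) · w)    ≈⟨ ∑-· (λ k → z k zero • proj₁ (Wq k)) w ⟨
        x · w                                      ∎))
    where
    open StarAlgebra A*
    open ≈-Reasoning
    d = part D i
    -- With `w` in every column this matrix belongs to the ideal, so it is fixed by `q`; one of its
    -- columns then shows that `q` fixes `w`.
    spread : Mat n n
    spread i _ = w i zero
    spread-col : ∀ j → col spread j ≈ w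
    spread-col = col-spread w
    W : Mat n n → Set
    W M = ∀ j → ∃[ x ] A x × col M j ≈ x · w
    W-subspace : Subspace W
    W-subspace = record
      { resp     = λ M≈N WM j → let x , Ax , e = WM j in x , Ax , ≈-trans (col-cong (≈-sym M≈N) j) e
      ; zero∈    = λ j → 𝟘 , zero∈ , ≈-trans (col-𝟘 j) (≈-sym (𝟘-· w))
      ; ⊕-closed = λ {M} {N} WM WN j → let x , Ax , e = WM j; y , Ay , f = WN j in
          x ⊕ y , ⊕-closed Ax Ay , ≈-trans (col-⊕ M N j) (≈-trans (⊕-cong e f) (≈-sym (·-distribʳ-⊕ w x y)))
      ; •-closed = λ c {M} WM j → let x , Ax , e = WM j in
          c • x , •-closed c Ax , ≈-trans (col-• c M j) (≈-trans (•-cong c e) (≈-sym (•-· c x w)))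
      }
    W-right : ∀ {M N} → W M → ⊤ → W (M · N)
    W-right {M} {N} WM _ j = ∑ (λ k → N k j • proj₁ (WM k))
      , ∑-closed _ (λ k → •-closed (N k j) (proj₁ (proj₂ (WM k)))) , (begin
        col (M · N) j                              ≈⟨ col-· M N j ⟩
        M · col N j                                ≈⟨ ·-as-∑ M (col N j) ⟩
        ∑ (λ k → col N j k zero • col M k)         ≈⟨ ∑-cong (λ k → ≈-trans (•-cong′ (col-entry N j k))
                                                          (≈-trans (•-cong (N k j) (proj₂ (proj₂ (WM k))))
                                                                   (≈-sym (•-· (N k j) (proj₁ (WM k)) w)))) ⟩
        ∑ (λ k → (N k j • proj₁ (WM k)) · w)       ≈⟨ ∑-· (λ k → N k j • proj₁ (WM k)) w ⟨
        ∑ (λ k → N k j • proj₁ (WM k)) · w         ∎)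
      where
      •-cong′ : ∀ {c c′} {X : Mat n 1} → c ≡ c′ → c • X ≈ c′ • X
      •-cong′ refl = ≈-refl

  -- For a part e of D and a part f of F with f e ≠ 0, take a nonzero column w of f e.
  -- As A w is the whole range of f, b w = x w with x ∈ A; as b − x is injective on e unless zero, b e = x e.
  same-rank⇒⊆ : {A B : Mat n n → Set} → StarAlgebra A → StarAlgebra B → (∀ {M} → A M → B M) →
    Decomposition A r → ¬ Decomposition B (suc r) →
    Decomposition (Commutant B) s → ¬ Decomposition (Commutant A) (suc s) →
    ∀ {b} → B b → ¬ ¬ A b
  same-rank⇒⊆ {n} {r} {s} {A} {B} A* B* A⊆B D D-finest F F-finest {b} Bb =
    ¬¬-∀ b·e∈A >>= λ be → return (resp (begin
      ∑ (λ c → b · part D c)    ≈⟨ ·-∑ b (part D) ⟨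
      b · ∑ (part D)            ≈⟨ ·-congˡ (complete D) ⟩
      b · 𝟙                     ≈⟨ ·-𝟙 b ⟩
      b                         ∎) (∑-closed _ be))
    where
    open StarAlgebra A*
    module B = StarAlgebra B*
    open ≈-Reasoning
    b·e∈A : ∀ c → ¬ ¬ A (b · part D c)
    -- The commutant of `A` contains that of `B`, so `F` is also a decomposition there, and
    -- `F-finest` makes `f` minimal in it.
    b·e∈A c = cyclic-on-part A* (Decomposition-mono (commutant-antitone A⊆B) F) F-finest j w (b · w)
                fw≈w w≉𝟘 (begin
                  f · (b · w)    ≈⟨ ·-assoc f b w ⟨
                  f · b · w      ≈⟨ ·-congʳ (part∈ F j Bb) ⟩
                  b · f · w      ≈⟨ ·-assoc b f w ⟩
                  b · (f · w)    ≈⟨ ·-congˡ fw≈w ⟩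
                  b · w          ∎) >>= λ (x , Ax , bw≈xw) →
      injective-on-part B* (Decomposition-mono A⊆B D) D-finest c (B.⊖-closed Bb (A⊆B Ax)) w ew≈w w≉𝟘
        (≈-trans (·-distribʳ-⊖ w b x) (≈⇒⊖≈𝟘 bw≈xw)) >>= λ [b⊖x]e≈𝟘 →
      return (resp (≈-sym (⊖≈𝟘⇒≈ (≈-trans (≈-sym (·-distribʳ-⊖ e b x)) [b⊖x]e≈𝟘))) (·-closed Ax (part∈ D c)))
      where
      e = part D c
      some-fe≉𝟘 : ∃[ j ] part F j · e ≉ 𝟘
      some-fe≉𝟘 = ¬∀⟶∃¬ s _ (λ j → ≈𝟘? (part F j · e)) λ all-𝟘 → part≉𝟘 D c (begin
        e                         ≈⟨ 𝟙-· e ⟨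
        𝟙 · e                     ≈⟨ ·-congʳ (complete F) ⟨
        ∑ (part F) · e            ≈⟨ ∑-· (part F) e ⟩
        ∑ (λ j → part F j · e)    ≈⟨ ∑-𝟘 _ all-𝟘 ⟩
        𝟘                         ∎)
      j = proj₁ some-fe≉𝟘
      f = part F j
      some-col≉𝟘 : ∃[ l ] col (f · e) l ≉ 𝟘
      some-col≉𝟘 = nonzero-col (f · e) (proj₂ some-fe≉𝟘)
      l = proj₁ some-col≉𝟘
      w = col (f · e) l
      w≉𝟘 : w ≉ 𝟘
      w≉𝟘 = proj₂ some-col≉𝟘
      fw≈w : f · w ≈ w
      fw≈w = ≈-trans (≈-sym (col-· f (f · e) l)) (col-cong
        (≈-trans (≈-sym (·-assoc f f e)) (·-congʳ (idempotent (projection F j)))) l)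
      -- The projection `f` commutes with `e`, because `e` lies in `A` and hence in `B`.
      ew≈w : e · w ≈ w
      ew≈w = ≈-trans (≈-sym (col-· e (f · e) l)) (col-cong (begin
        e · (f · e)    ≈⟨ ·-assoc e f e ⟨
        e · f · e      ≈⟨ ·-congʳ (part∈ F j (A⊆B (part∈ D c))) ⟨
        f · e · e      ≈⟨ ·-assoc f e e ⟩
        f · (e · e)    ≈⟨ ·-congˡ (idempotent (projection D c)) ⟩
        f · e          ∎) l)

  -- Words, their spans and generated algebras.

  product : List (Mat n n) → Mat n n
  product = foldr _·_ 𝟙

  product-++ : (Ms Ns : List (Mat n n)) → product (Ms ++ Ns) ≈ product Ms · product Ns
  product-++ []       Ns = ≈-sym (𝟙-· (product Ns))
  product-++ (M ∷ Ms) Ns = ≈-trans (·-congˡ (product-++ Ms Ns)) (≈-sym (·-assoc M (product Ms) (product Ns)))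

  data Span (S : Mat n n → Set) (k : ℕ) : Mat n n → Set where
    word   : ∀ {Ms} → All S Ms → length Ms ℕ.≤ k → Span S k (product Ms)
    zero′  : Span S k 𝟘
    _⊕′_   : ∀ {M N} → Span S k M → Span S k N → Span S k (M ⊕ N)
    _•′_   : ∀ c {M} → Span S k M → Span S k (c • M)
    resp′  : ∀ {M N} → M ≈ N → Span S k M → Span S k N

  module _ {S : Mat n n → Set} where

    Span-subspace : Subspace (Span S k)
    Span-subspace = record { resp = resp′ ; zero∈ = zero′ ; ⊕-closed = _⊕′_ ; •-closed = _•′_ }

    Span-elim : {W : Mat n n → Set} → Subspace W → (∀ {Ms} → All S Ms → length Ms ℕ.≤ k → W (product Ms)) →
      ∀ {M} → Span S k M → W M
    Span-elim {W = W} W-subspace on-word = go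
      where
      open Subspace W-subspace
      go : ∀ {M} → Span S _ M → W M
      go (word Ms l)   = on-word Ms l
      go zero′         = zero∈
      go (M ⊕′ N)      = ⊕-closed (go M) (go N)
      go (c •′ M)      = •-closed c (go M)
      go (resp′ e M)   = resp e (go M)

    Span-mono : ∀ {j} → j ℕ.≤ k → ∀ {M} → Span S j M → Span S k M
    Span-mono j≤k = Span-elim Span-subspace λ Ms l → word Ms (ℕₚ.≤-trans l j≤k)

    -- Together with `preimage-·ʳ` this lets `Span-elim` treat a product one factor at a time.
    preimage-·ˡ : {W : Mat n n → Set} → Subspace W → (M : Mat n n) → Subspace {n} {n} (λ N → W (M · N))
    preimage-·ˡ W-subspace M = record
      { resp     = λ e → resp (·-congˡ e)
      ; zero∈    = resp (≈-sym (·-𝟘 M)) zero∈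
      ; ⊕-closed = λ {X} {Y} x y → resp (≈-sym (·-distribˡ-⊕ M X Y)) (⊕-closed x y)
      ; •-closed = λ c {X} x → resp (≈-sym (·-• c M X)) (•-closed c x)
      }
      where open Subspace W-subspace

    preimage-·ʳ : {W : Mat n n → Set} → Subspace W → (M : Mat n n) → Subspace {n} {n} (λ N → W (N · M))
    preimage-·ʳ W-subspace M = record
      { resp     = λ e → resp (·-congʳ e)
      ; zero∈    = resp (≈-sym (𝟘-· M)) zero∈
      ; ⊕-closed = λ {X} {Y} x y → resp (≈-sym (·-distribʳ-⊕ M X Y)) (⊕-closed x y)
      ; •-closed = λ c {X} x → resp (≈-sym (•-· c X M)) (•-closed c x)
      }
      where open Subspace W-subspace

    preimage-ᵀ : {W : Mat n n → Set} → Subspace W → Subspace (λ N → W (N ᵀ))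
    preimage-ᵀ W-subspace = record
      { resp     = λ e → resp (ᵀ-cong e)
      ; zero∈    = resp (≈-sym ᵀ-𝟘) zero∈
      ; ⊕-closed = λ {X} {Y} x y → resp (≈-sym (ᵀ-⊕ X Y)) (⊕-closed x y)
      ; •-closed = λ c {X} x → resp (≈-sym (ᵀ-• c X)) (•-closed c x)
      }
      where open Subspace W-subspace

    Span-· : ∀ {j} {M N} → Span S j M → Span S k N → Span S (j ℕ.+ k) (M · N)
    Span-· {N = N} M∈ N∈ = Span-elim (preimage-·ʳ Span-subspace N) (λ {Ms} Ms∈ l →
      Span-elim (preimage-·ˡ Span-subspace (product Ms)) (λ {Ns} Ns∈ l′ →
        resp′ (product-++ Ms Ns) (word (Allₚ.++⁺ Ms∈ Ns∈)
          (subst (ℕ._≤ _) (sym (length-++ Ms)) (ℕₚ.+-mono-≤ l l′)))) N∈) M∈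

    -- Transposing a word reverses it and transposes its letters, which keeps the length.
    product-ᵀ : (∀ {M} → S M → S (M ᵀ)) → ∀ {Ms} → All S Ms → Span S (length Ms) (product Ms ᵀ)
    product-ᵀ S-ᵀ []              = resp′ (≈-sym 𝟙-ᵀ) (word [] z≤n)
    product-ᵀ S-ᵀ {M ∷ Ms} (m ∷ ms) = resp′ (≈-sym (·-ᵀ M (product Ms)))
      (Span-mono (ℕₚ.≤-reflexive (ℕₚ.+-comm (length Ms) 1))
        (Span-· (product-ᵀ S-ᵀ ms) (resp′ (·-𝟙 (M ᵀ)) (word (S-ᵀ m ∷ []) ℕₚ.≤-refl))))

    Generated : Mat n n → Set
    Generated M = ∃[ k ] Span S k M

    generated-algebra : (∀ {M} → S M → S (M ᵀ)) → StarAlgebra Generated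
    generated-algebra S-ᵀ = record
      { subspace = record
        { resp     = λ e (k , M∈) → k , resp′ e M∈
        ; zero∈    = 0 , zero′
        ; ⊕-closed = λ (j , M∈) (k , N∈) → j ℕ.+ k ,
            (Span-mono (ℕₚ.m≤m+n j k) M∈ ⊕′ Span-mono (ℕₚ.m≤n+m k j) N∈)
        ; •-closed = λ c (k , M∈) → k , (c •′ M∈)
        }
      ; 𝟙∈       = 0 , word [] z≤n
      ; ·-closed = λ (j , M∈) (k , N∈) → j ℕ.+ k , Span-· M∈ N∈
      ; ᵀ-closed = λ (k , M∈) → k , Span-elim (preimage-ᵀ Span-subspace) (λ Ms∈ l → Span-mono l (product-ᵀ S-ᵀ Ms∈)) M∈
      }

    ⊆Generated : ∀ {M} → S M → Generated M
    ⊆Generated {M} M∈ = 1 , resp′ (·-𝟙 M) (word (M∈ ∷ []) ℕₚ.≤-refl)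

    -- Words with one more letter add nothing to the span.
    Stable : ℕ → Set
    Stable k = ∀ {M} → Span S (suc k) M → ¬ ¬ Span S k M

    -- Every unstable length `j` provides a matrix of length `suc j` outside the span for `j`.
    -- Subtracting its projection onto that span leaves a new nonzero member orthogonal to the
    -- earlier ones.
    unstable⇒orthogonal : ∀ k → (∀ j → j ℕ.< k → ¬ Stable j) → ¬ ¬ OrthogonalFamily (Span S k) k
    unstable⇒orthogonal zero    unstable = return
      record { vec = λ () ; member = λ () ; nonzero = λ () ; orthogonal = λ () }
    unstable⇒orthogonal (suc k) unstable =
      unstable⇒orthogonal k (λ j j<k → unstable j (ℕₚ.m<n⇒m<1+n j<k)) >>= λ F →
      ¬¬-excluded-middle {A = ∃[ M ] Span S (suc k) M × ¬ Span S k M} >>= λ where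
        (no none) → λ _ → unstableₖ λ {M} M∈ M∉ → none (M , M∈ , M∉)
        (yes (M , M∈ , M∉)) → orthogonal-projection Span-subspace M >>= λ (e , e∈ , M⊖e⟂) →
          return (extend Span-subspace
            (record { vec = vec F ; member = λ i → Span-mono (ℕₚ.n≤1+n k) (member F i)
                    ; nonzero = nonzero F ; orthogonal = orthogonal F })
            (M ⊖ e) (Subspace.⊖-closed Span-subspace M∈ (Span-mono (ℕₚ.n≤1+n k) e∈))
            (λ M⊖e≈𝟘 → M∉ (resp′ (≈-sym (⊖≈𝟘⇒≈ M⊖e≈𝟘)) e∈))
            (λ i → M⊖e⟂ (vec F i) (member F i)))
      where unstableₖ = unstable k ℕₚ.≤-refl

    unstable-bound : ¬ (∀ j → j ℕ.≤ n ℕ.* n → ¬ Stable j)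
    unstable-bound unstable = unstable⇒orthogonal (suc (n ℕ.* n)) (λ j j<k → unstable j (ℕₚ.≤-pred j<k))
      λ F → ℕₚ.1+n≰n (orthogonal-bound F)

    -- This makes `Span-elim` applicable to doubly negated conclusions.
    ¬¬-subspace : {W : Mat n n → Set} → Subspace W → Subspace (λ M → ¬ ¬ W M)
    ¬¬-subspace W-subspace = record
      { resp     = λ e m → m >>= λ m′ → return (resp e m′)
      ; zero∈    = return zero∈
      ; ⊕-closed = λ m n → m >>= λ m′ → n >>= λ n′ → return (⊕-closed m′ n′)
      ; •-closed = λ c m → m >>= λ m′ → return (•-closed c m′)
      }
      where open Subspace W-subspace

    -- Prepending a letter to an element of the span for `k` gives one for `suc k`, which stability
    -- brings back; induction on the word handles any length.
    stable-words : Stable k → ∀ {Ms} → All S Ms → ¬ ¬ Span S k (product Ms)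
    stable-words stable []                = return (word [] z≤n)
    stable-words stable (_∷_ {x = M} m ms) = stable-words stable ms >>= λ ms∈ →
      stable (resp′ (·-congʳ (·-𝟙 M)) (Span-· (word (m ∷ []) ℕₚ.≤-refl) ms∈))

    -- Some length up to `n * n` is stable, as otherwise there would be more than `n * n` orthogonal
    -- matrices. From that length on the span no longer grows.
    generated⊆Span : ∀ {M} → Generated M → ¬ ¬ Span S (n ℕ.* n) M
    generated⊆Span (_ , M∈) =
      ¬¬-excluded-middle {A = ∃[ j ] j ℕ.≤ n ℕ.* n × Stable j} >>= λ where
        (yes (j , j≤n² , stable)) → Span-elim (¬¬-subspace Span-subspace) (λ Ms∈ _ → stable-words stable Ms∈) M∈ >>= λ M∈′ →
          return (Span-mono j≤n² M∈′)
        (no none) → λ _ → unstable-bound λ j j≤ st → none (j , j≤ , st)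

  -- Filtrations and chains of algebras.

  -- T plays the role of the matrices constant on the colour classes after m rounds.
  record Filtration (T : ℕ → Mat n n → Set) : Set where
    field
      subspace : ∀ m → Subspace (T m)
      𝟙∈       : ∀ m → T m 𝟙
      ᵀ-closed : ∀ m {M} → T m M → T m (M ᵀ)
      ·-step   : ∀ m {M N} → T m M → T m N → T (suc m) (M · N)
      ¬¬-stable : ∀ m {M} → ¬ ¬ T m M → T m M

    step : ∀ m {M} → T m M → T (suc m) M
    step m {M} M∈ = Subspace.resp (subspace (suc m)) (·-𝟙 M) (·-step m M∈ (𝟙∈ m))

    steps : ∀ k m {M} → T m M → T (k ℕ.+ m) M
    steps zero    m M∈ = M∈
    steps (suc k) m M∈ = step (k ℕ.+ m) (steps k m M∈)

    -- Cutting a word of length at most `2 ^ suc k` after `2 ^ k` letters leaves two words for the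
    -- induction hypothesis, and one further step multiplies them.
    words : ∀ k m {Ms} → All (T m) Ms → length Ms ℕ.≤ 2 ℕ.^ k → T (k ℕ.+ m) (product Ms)
    words zero    m {[]}         []        l = 𝟙∈ m
    words zero    m {M ∷ []}     (M∈ ∷ []) l = Subspace.resp (subspace m) (≈-sym (·-𝟙 M)) M∈
    words zero    m {_ ∷ _ ∷ _}  _ (s≤s ())
    words (suc k) m {Ms}         Ms∈       l = Subspace.resp (subspace _)
      (≈-trans (≈-sym (product-++ (take h Ms) (drop h Ms))) (≡⇒≈ (cong product (take++drop≡id h Ms))))
      (·-step (k ℕ.+ m)
        (words k m (Allₚ.take⁺ h Ms∈) (subst (ℕ._≤ h) (sym (length-take h Ms)) (ℕₚ.m⊓n≤m h (length Ms))))
        (words k m (Allₚ.drop⁺ h Ms∈) (subst (ℕ._≤ h) (sym (length-drop h Ms))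
          (ℕₚ.m≤n+o⇒m∸n≤o _ h (subst (λ x → length Ms ℕ.≤ h ℕ.+ x) (ℕₚ.+-identityʳ h) l)))))
      where
      h = 2 ℕ.^ k
      ≡⇒≈ : {M N : Mat n n} → M ≡ N → M ≈ N
      ≡⇒≈ refl = ≈-refl

    generated⊆ : ∀ k m → n ℕ.* n ℕ.≤ 2 ℕ.^ k → ∀ {M} → Generated {S = T m} M → T (k ℕ.+ m) M
    generated⊆ k m n²≤2ᵏ M∈ = ¬¬-stable _ (generated⊆Span M∈ >>= λ M∈′ →
      return (Span-elim (subspace _) (λ Ms∈ l → words k m Ms∈ (ℕₚ.≤-trans l n²≤2ᵏ)) M∈′))

  Closed : (Mat n n → Set) → Set
  Closed W = ∀ {M N} → W M → W N → W (M · N)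

  module _ {T : ℕ → Mat (suc n) (suc n) → Set} (𝕋 : Filtration T)
           (K : ℕ) (n²≤2ᴷ : suc n ℕ.* suc n ℕ.≤ 2 ℕ.^ K) where
    open Filtration 𝕋

    A : ℕ → Mat (suc n) (suc n) → Set
    A t = Generated {S = T (t ℕ.* K)}

    A* : ∀ t → StarAlgebra (A t)
    A* t = generated-algebra (ᵀ-closed (t ℕ.* K))

    A-step : ∀ t {M} → A t M → A (suc t) M
    A-step t (k , M∈) = k , Span-elim Span-subspace (λ Ms∈ l → word (All.map (steps K (t ℕ.* K)) Ms∈) l) M∈

    -- Relations and not functions, since the maxima are available only up to double negation.
    Rank Corank : ℕ → ℕ → Set
    Rank t   = Greatest (Decomposition (A t))
    Corank t = Greatest (Decomposition (Commutant (A t)))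

    rank-exists : ∀ t → ¬ ¬ (∃[ r ] Rank t r)
    rank-exists t = greatest _ (suc n) (λ _ → decomposition-bound) 1 (trivial-decomposition (A* t))

    corank-exists : ∀ t → ¬ ¬ (∃[ s ] Corank t s)
    corank-exists t = greatest _ (suc n) (λ _ → decomposition-bound) 1
      (trivial-decomposition (commutant-algebra (A* t)))

    -- The product of `M` and `N` lies in `A (suc t)`, which equals `A t` up to double negation when
    -- both ranks persist. Elements of `A t` are reached within `K` further rounds, and `suc t * K`
    -- unfolds to `K + t * K`.
    same-rank⇒closed : ∀ t → Rank t r → Corank t s → Rank (suc t) r → Corank (suc t) s → Closed (T (suc t ℕ.* K))
    same-rank⇒closed t (D , _) (_ , s-max) (_ , r-max) (F , _) M∈ N∈ = ¬¬-stable _ (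
      same-rank⇒⊆ (A* t) (A* (suc t)) (A-step t)
        D (λ D′ → ℕₚ.1+n≰n (r-max _ D′)) F (λ F′ → ℕₚ.1+n≰n (s-max _ F′))
        (StarAlgebra.·-closed (A* (suc t)) (⊆Generated M∈) (⊆Generated N∈)) >>= λ MN∈ →
      return (generated⊆ K (t ℕ.* K) n²≤2ᴷ MN∈))

    -- Without closedness each block of `K` rounds raises the rank or lowers the corank, and neither
    -- ever moves the other way. The inequality states that rank minus corank plus the matrix size
    -- is at least `t`, avoiding subtraction.
    rank-growth : ∀ t → (∀ i → i ℕ.< t → ¬ Closed (T (suc i ℕ.* K))) →
      ¬ ¬ (∃[ r ] ∃[ s ] Rank t r × Corank t s × t ℕ.+ s ℕ.≤ r ℕ.+ suc n)
    rank-growth zero    _ = rank-exists 0 >>= λ (r , R) → corank-exists 0 >>= λ (s , S) →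
      return (r , s , R , S , ℕₚ.≤-trans (decomposition-bound (proj₁ S)) (ℕₚ.m≤n+m (suc n) r))
    rank-growth (suc t) not-closed =
      rank-growth t (λ i i<t → not-closed i (ℕₚ.m<n⇒m<1+n i<t)) >>= λ (r , s , R , S , t+s≤r+n) →
      rank-exists (suc t) >>= λ (r′ , R′) → corank-exists (suc t) >>= λ (s′ , S′) →
      let r≤r′ = proj₂ R′ r (Decomposition-mono (A-step t) (proj₁ R))
          s′≤s = proj₂ S s′ (Decomposition-mono (commutant-antitone (A-step t)) (proj₁ S′))
      in return (r′ , s′ , R′ , S′ , grow R S R′ S′ t+s≤r+n r≤r′ s′≤s)
      where
      grow : ∀ {r s r′ s′} → Rank t r → Corank t s → Rank (suc t) r′ → Corank (suc t) s′ →
        t ℕ.+ s ℕ.≤ r ℕ.+ suc n → r ℕ.≤ r′ → s′ ℕ.≤ s → suc t ℕ.+ s′ ℕ.≤ r′ ℕ.+ suc n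
      grow {r} {s} {r′} {s′} R S R′ S′ t+s≤r+n r≤r′ s′≤s with ℕₚ.m≤n⇒m<n∨m≡n r≤r′ | ℕₚ.m≤n⇒m<n∨m≡n s′≤s
      ... | inj₁ r<r′ | _         = ℕₚ.≤-trans (s≤s (ℕₚ.≤-trans (ℕₚ.+-monoʳ-≤ t s′≤s) t+s≤r+n)) (ℕₚ.+-monoˡ-≤ (suc n) r<r′)
      ... | inj₂ refl | inj₁ s′<s = ℕₚ.≤-trans (subst (ℕ._≤ t ℕ.+ s) (ℕₚ.+-suc t s′) (ℕₚ.+-monoʳ-≤ t s′<s)) t+s≤r+n
      ... | inj₂ refl | inj₂ refl = contradiction (λ {M} {N} → same-rank⇒closed t R S R′ S′ {M} {N}) (not-closed t ℕₚ.≤-refl)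

    eventually-closed : ¬ (∀ i → i ℕ.≤ suc n ℕ.+ suc n → ¬ Closed (T (suc i ℕ.* K)))
    -- With `N` the matrix size and `t = 2N + 1`, the growth inequality and `r ≤ N` would give
    -- `t ≤ 2N`.
    eventually-closed not-closed = rank-growth (suc (suc n ℕ.+ suc n)) (λ i i<t → not-closed i (ℕₚ.≤-pred i<t))
      λ (r , s , R , _ , t+s≤r+n) → ℕₚ.1+n≰n (ℕₚ.≤-trans (ℕₚ.m≤m+n _ s)
        (ℕₚ.≤-trans t+s≤r+n (ℕₚ.+-monoˡ-≤ (suc n) (decomposition-bound (proj₁ R)))))

  -- Indicators, counts and matchings.

  indicator : {P : Set} → Dec P → ℚ
  indicator P? = if does P? then 1ℚ else 0ℚ

  indicator-⇔ : {P Q : Set} (P? : Dec P) (Q? : Dec Q) → (P → Q) → (Q → P) → indicator P? ≡ indicator Q?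
  indicator-⇔ (yes _) (yes _) _   _   = refl
  indicator-⇔ (yes p) (no ¬q) p→q _   = contradiction (p→q p) ¬q
  indicator-⇔ (no ¬p) (yes q) _   q→p = contradiction (q→p q) ¬p
  indicator-⇔ (no _)  (no _)  _   _   = refl

  indicator-yes : {P : Set} (P? : Dec P) → P → indicator P? ≡ 1ℚ
  indicator-yes P? p = indicator-⇔ P? (yes tt) (λ _ → tt) (λ _ → p)

  indicator-no : {P : Set} (P? : Dec P) → ¬ P → indicator P? ≡ 0ℚ
  indicator-no (yes p) ¬p = contradiction p ¬p
  indicator-no (no _)  _  = refl

  0≤indicator : {P : Set} (P? : Dec P) → 0ℚ ≤ indicator P?
  0≤indicator (yes _) = nonNegative⁻¹ 1ℚ
  0≤indicator (no _)  = ≤-refl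

  indicator-× : {P Q : Set} (P? : Dec P) (Q? : Dec Q) → indicator (P? ×-dec Q?) ≡ indicator P? * indicator Q?
  indicator-× (yes _) Q? = sym (*-identityˡ (indicator Q?))
  indicator-× (no _)  Q? = sym (*-zeroˡ (indicator Q?))

  module Matching {X : Set} {_∼_ : Rel X 0ℓ} (∼-equiv : IsEquivalence _∼_) (_∼?_ : Decidable _∼_) where
    open IsEquivalence ∼-equiv using () renaming (refl to ∼-refl; sym to ∼-sym; trans to ∼-trans)

    -- The count is rational so that it can be compared with entries of matrix products.
    count : (Fin n → X) → X → ℚ
    count f x = sum (λ w → indicator (f w ∼? x))

    Matching : (f g : Fin n → X) → Set
    Matching {n} f g = Σ[ σ ∈ Permutation′ n ] (∀ w → f w ∼ g (σ ⟨$⟩ʳ w))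

    matching⇒count : (f g : Fin n → X) → Matching f g → ∀ x → count f x ≡ count g x
    matching⇒count f g (σ , f∼gσ) x = trans
      (sum-cong-≗ λ w → indicator-⇔ (f w ∼? x) (g (σ ⟨$⟩ʳ w) ∼? x) (∼-trans (∼-sym (f∼gσ w))) (∼-trans (f∼gσ w)))
      (sym (sum-permute (λ w → indicator (g w ∼? x)) σ))

    -- Match `f zero` with some equivalent `g w` and delete both. Their contributions to every count
    -- agree, so the remaining counts still agree.
    count⇒matching : (f g : Fin n → X) → (∀ w → count f (f w) ≡ count g (f w)) → Matching f g
    count⇒matching {zero}  f g _  = Perm.id , λ ()
    count⇒matching {suc n} f g eq with any? (λ w → g w ∼? f zero)
    -- Without a partner the count in `g` is zero, whereas `f zero` itself contributes 1 to the
    -- count in `f`.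
    ... | no  none = contradiction (trans (sym (indicator-yes (f zero ∼? f zero) ∼-refl))
          (sum≡0⇒≡0 _ (λ w → 0≤indicator (f w ∼? f zero))
            (trans (eq zero) (sum-zero _ λ w → indicator-no (g w ∼? f zero) λ gw∼f0 → none (w , gw∼f0))) zero)) λ ()
    ... | yes (w , gw∼f0) = Perm.insert zero w (proj₁ rest) , λ where
            zero    → ∼-sym gw∼f0
            (suc k) → subst (λ z → f (suc k) ∼ g z) (sym (Perm.insert-punchIn zero w (proj₁ rest) k)) (proj₂ rest k)
      where
      rest-eq : ∀ k → count (f ∘ suc) (f (suc k)) ≡ count (g ∘ punchIn w) (f (suc k))
      rest-eq k = +-cancelˡ (indicator (f zero ∼? x)) _ _ (begin
        indicator (f zero ∼? x) + count (f ∘ suc) x       ≡⟨ eq (suc k) ⟩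
        count g x                                         ≡⟨ sum-remove {i = w} (λ v → indicator (g v ∼? x)) ⟩
        indicator (g w ∼? x) + count (g ∘ punchIn w) x    ≡⟨ cong (_+ count (g ∘ punchIn w) x)
                                                               (indicator-⇔ (g w ∼? x) (f zero ∼? x)
                                                                 (∼-trans (∼-sym gw∼f0)) (∼-trans gw∼f0)) ⟩
        indicator (f zero ∼? x) + count (g ∘ punchIn w) x ∎)
        where
        open ≡-Reasoning
        x = f (suc k)
      rest : Matching (f ∘ suc) (g ∘ punchIn w)
      rest = count⇒matching (f ∘ suc) (g ∘ punchIn w) rest-eq

    -- Finitely many comparisons of counts replace a search through permutations.
    matching? : (f g : Fin n → X) → Dec (Matching f g)
    matching? f g = map′ (count⇒matching f g) (λ fg w → matching⇒count f g fg (f w))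
      (all? λ w → count f (f w) ≟ count g (f w))

  -- Colour classes of the Weisfeiler-Leman refinement.

  module Colors {n} (G : Graph n) where

    SameColor-equivalence : ∀ m → IsEquivalence (SameColor G m)
    SameColor-equivalence m = record { refl = ∼-refl m ; sym = ∼-sym m ; trans = ∼-trans m }
      where
      ∼-refl : ∀ m {p} → SameColor G m p p
      ∼-refl zero    = refl
      ∼-refl (suc m) = Perm.id , λ w → ∼-refl m , ∼-refl m

      ∼-sym : ∀ m {p q} → SameColor G m p q → SameColor G m q p
      ∼-sym zero    e = sym e
      ∼-sym (suc m) {u , v} {u′ , v′} (σ , h) = Perm.flip σ , λ w →
        let h₁ , h₂ = h (σ ⟨$⟩ˡ w)
        in ∼-sym m (subst (λ x → SameColor G m (u , σ ⟨$⟩ˡ w) (u′ , x)) (Perm.inverseʳ σ) h₁)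
         , ∼-sym m (subst (λ x → SameColor G m (σ ⟨$⟩ˡ w , v) (x , v′)) (Perm.inverseʳ σ) h₂)

      ∼-trans : ∀ m {p q r} → SameColor G m p q → SameColor G m q r → SameColor G m p r
      ∼-trans zero    e f = trans e f
      ∼-trans (suc m) (σ , h) (τ , k) = σ Perm.∘ₚ τ , λ w →
        let h₁ , h₂ = h w
            k₁ , k₂ = k (σ ⟨$⟩ʳ w)
        in ∼-trans m h₁ k₁ , ∼-trans m h₂ k₂

    -- Pairs of positions stand for pairs of colours. With `SameType` and `type`, the relation
    -- `SameColor G (suc m)` unfolds to a `Matching` of `type p` with `type q`.
    Type : Set
    Type = (Fin n × Fin n) × (Fin n × Fin n)

    SameType : ℕ → Rel Type 0ℓ
    SameType m (p , q) (p′ , q′) = SameColor G m p p′ × SameColor G m q q′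

    type : Fin n × Fin n → Fin n → Type
    type (u , v) w = (u , w) , (w , v)

    SameType-equivalence : ∀ m → IsEquivalence (SameType m)
    SameType-equivalence m = record
      { refl  = ∼-refl , ∼-refl
      ; sym   = λ (e , f) → ∼-sym e , ∼-sym f
      ; trans = λ (e , f) (e′ , f′) → ∼-trans e e′ , ∼-trans f f′
      }
      where open IsEquivalence (SameColor-equivalence m) renaming (refl to ∼-refl; sym to ∼-sym; trans to ∼-trans)

    sameColor? : ∀ m → Decidable (SameColor G m)
    sameType? : ∀ m → Decidable (SameType m)
    sameType? m (p , q) (p′ , q′) = sameColor? m p p′ ×-dec sameColor? m q q′
    sameColor? zero    p q = initColor G (proj₁ p) (proj₂ p) ≟ᶻ initColor G (proj₁ q) (proj₂ q)
    sameColor? (suc m) p q = Matching.matching? (SameType-equivalence m) (sameType? m) (type p) (type q)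

    -- The initial colour -1 occurs on the diagonal only. In later rounds, taking `w = u` compares
    -- `(u , u)` with `(u′ , σ u)` and with `(σ u , v′)`, so `u′ = σ u = v′`.
    diagonal : ∀ m {u v u′ v′} → SameColor G m (u , v) (u′ , v′) → u ≡ v → u′ ≡ v′
    diagonal zero {u} {.u} {u′} {v′} e refl with u ≟ᶠ u | u′ ≟ᶠ v′
    ... | _       | yes u′≡v′ = u′≡v′
    ... | no  u≢u | no _      = contradiction refl u≢u
    ... | yes _   | no _      with adj G u′ v′
    diagonal zero () refl | yes _ | no _ | true
    diagonal zero () refl | yes _ | no _ | false
    diagonal (suc m) {u} (σ , h) refl = trans (diagonal m (proj₁ (h u)) refl) (diagonal m (proj₂ (h u)) refl)

    -- At `w = v` the second component sends the diagonal pair `(v , v)` to `(σ v , v′)`. Hence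
    -- `σ v = v′`, and the first component is the claim.
    refines : ∀ m {p q} → SameColor G (suc m) p q → SameColor G m p q
    refines m {u , v} {u′ , v′} (σ , h) =
      subst (λ x → SameColor G m (u , v) (u′ , x)) (diagonal m (proj₂ (h v)) refl) (proj₁ (h v))

    initColor-sym : ∀ u v → initColor G u v ≡ initColor G v u
    initColor-sym u v with u ≟ᶠ v | v ≟ᶠ u
    ... | yes _   | yes _   = refl
    ... | yes u≡v | no v≢u  = contradiction (sym u≡v) v≢u
    ... | no u≢v  | yes v≡u = contradiction (sym v≡u) u≢v
    ... | no _    | no _    rewrite adj-sym G u v = refl

    SameColor-ᵀ : ∀ m {u v u′ v′} → SameColor G m (u , v) (u′ , v′) → SameColor G m (v , u) (v′ , u′)
    SameColor-ᵀ zero {u} {v} {u′} {v′} e = trans (initColor-sym v u) (trans e (initColor-sym u′ v′))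
    SameColor-ᵀ (suc m) (σ , h) = σ , λ w → SameColor-ᵀ m (proj₂ (h w)) , SameColor-ᵀ m (proj₁ (h w))

    Invariant : ℕ → Mat n n → Set
    Invariant m M = ∀ {u v u′ v′} → SameColor G m (u , v) (u′ , v′) → M u v ≡ M u′ v′

    opaque
      unfolding _⊕_

      invariant-filtration : Filtration Invariant
      invariant-filtration = record
        { subspace  = λ m → record
          { resp     = λ M≈N inv {u} {v} {u′} {v′} e → trans (sym (at M≈N u v)) (trans (inv e) (at M≈N u′ v′))
          ; zero∈    = λ _ → refl
          ; ⊕-closed = λ invM invN e → cong₂ _+_ (invM e) (invN e)
          ; •-closed = λ c invM e → cong (c *_) (invM e)
          }
        ; 𝟙∈        = λ m {u} {v} e → δ-invariant m e (u ≟ᶠ v)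
        ; ᵀ-closed  = λ m invM e → invM (SameColor-ᵀ m e)
        -- The permutation that matches the multisets reindexes the sum defining the matrix product.
        ; ·-step    = λ m {M} {N} invM invN {u} {v} {u′} {v′} (σ , h) → trans
            (sum-cong-≗ λ w → cong₂ _*_ (invM (proj₁ (h w))) (invN (proj₂ (h w))))
            (sym (sum-permute (λ w → M u′ w * N w v′) σ))
        ; ¬¬-stable = λ m {M} inv {u} {v} {u′} {v′} e → decidable-stable (M u v ≟ M u′ v′)
            (inv >>= λ inv′ → return (inv′ e))
        }
        where
        δ-invariant : ∀ m {u v u′ v′} → SameColor G m (u , v) (u′ , v′) → Dec (u ≡ v) → δ u v ≡ δ u′ v′
        δ-invariant m {u} {v} {u′} {v′} e (yes refl) = trans (δ-refl u)
          (sym (trans (cong (λ x → δ x v′) (diagonal m e refl)) (δ-refl v′)))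
        δ-invariant m {u} {v} {u′} {v′} e (no u≢v)   = trans (δ-≢ u v u≢v)
          (sym (δ-≢ u′ v′ (u≢v ∘ diagonal m (IsEquivalence.sym (SameColor-equivalence m) e))))

      -- The product of the indicator matrices of two colours counts the w with a given pair of colours.
      closed⇒stable : ∀ m → Closed (Invariant m) → SamePartition G m
      closed⇒stable m closed p q = mk⇔ to (refines m)
        where
        open IsEquivalence (SameColor-equivalence m) renaming (sym to ∼-sym; trans to ∼-trans)
        open Matching (SameType-equivalence m) (sameType? m)
        class : Fin n × Fin n → Mat n n
        class x u v = indicator (sameColor? m (u , v) x)
        class-invariant : ∀ x → Invariant m (class x)
        class-invariant x e = indicator-⇔ (sameColor? m _ x) (sameColor? m _ x) (∼-trans (∼-sym e)) (∼-trans e)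
        count-class : ∀ p x y → count (type p) (x , y) ≡ (class x · class y) (proj₁ p) (proj₂ p)
        count-class (u , v) x y = sum-cong-≗ λ w →
          indicator-× (sameColor? m (u , w) x) (sameColor? m (w , v) y)
        to : SameColor G m p q → SameColor G (suc m) p q
        to e = count⇒matching (type p) (type q) λ w →
          let x , y = type p w in
          trans (count-class p x y) (trans (closed (class-invariant x) (class-invariant y) e) (sym (count-class q x y)))

    samePartition? : ∀ m → Dec (SamePartition G m)
    samePartition? m = map′ (λ h p q → mk⇔ (h (proj₁ p) (proj₂ p) (proj₁ q) (proj₂ q)) (refines m))
      (λ h u v u′ v′ → Equivalence.to (h (u , v) (u′ , v′)))
      (all? λ u → all? λ v → all? λ u′ → all? λ v′ → sameColor? m (u , v) (u′ , v′) →-dec sameColor? (suc m) (u , v) (u′ , v′))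

-- Logarithms and the final count of rounds.

open import Data.Nat using (ℕ; _≤_; _<_; _*_)
open import Data.Nat.Logarithm using (⌊log₂_⌋; ⌊log₂⌋-mono-≤; ⌊log₂[2^n]⌋≡n)
open import Data.Nat.Tactic.RingSolver using (solve-∀)
open import Data.Product using (_×_; _,_; ∃-syntax)
open import Relation.Binary.PropositionalEquality using (_≡_; sym; subst)
open import Relation.Nullary.Decidable using (decidable-stable; map′)

n<2^[1+⌊log₂n⌋] : ∀ n → n < 2 ℕ.^ ℕ.suc ⌊log₂ n ⌋
n<2^[1+⌊log₂n⌋] n = ℕₚ.≰⇒> λ 2^≤n →
  ℕₚ.1+n≰n (subst (_≤ ⌊log₂ n ⌋) (⌊log₂[2^n]⌋≡n (ℕ.suc ⌊log₂ n ⌋)) (⌊log₂⌋-mono-≤ 2^≤n))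

1≤⌊log₂n⌋ : ∀ {n} → 2 ≤ n → 1 ≤ ⌊log₂ n ⌋
1≤⌊log₂n⌋ {n} 2≤n = subst (_≤ ⌊log₂ n ⌋) (⌊log₂[2^n]⌋≡n 1) (⌊log₂⌋-mono-≤ 2≤n)

-- This exponent serves as the block length `K`.
n*n≤2^[1+⌊log₂n⌋+1+⌊log₂n⌋] : ∀ n → n * n ≤ 2 ℕ.^ (ℕ.suc ⌊log₂ n ⌋ ℕ.+ ℕ.suc ⌊log₂ n ⌋)
n*n≤2^[1+⌊log₂n⌋+1+⌊log₂n⌋] n = subst (n * n ≤_)
  (sym (ℕₚ.^-distribˡ-+-* 2 (ℕ.suc ⌊log₂ n ⌋) (ℕ.suc ⌊log₂ n ⌋)))
  (ℕₚ.*-mono-≤ (ℕₚ.<⇒≤ (n<2^[1+⌊log₂n⌋] n)) (ℕₚ.<⇒≤ (n<2^[1+⌊log₂n⌋] n)))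

-- The factors are at most `3 n` and `4 L`, whence the constant 12.
rounds-bound : ∀ n L i → 1 ≤ n → 1 ≤ L → i ≤ n ℕ.+ n →
  ℕ.suc i * (ℕ.suc L ℕ.+ ℕ.suc L) ≤ 12 * (n * L)
rounds-bound n L i 1≤n 1≤L i≤2n = begin
  ℕ.suc i * (ℕ.suc L ℕ.+ ℕ.suc L)            ≤⟨ ℕₚ.*-mono-≤ (ℕₚ.+-mono-≤ 1≤n i≤2n)
                                                  (ℕₚ.+-mono-≤ (ℕₚ.+-monoˡ-≤ L 1≤L) (ℕₚ.+-monoˡ-≤ L 1≤L)) ⟩
  (n ℕ.+ (n ℕ.+ n)) * (L ℕ.+ L ℕ.+ (L ℕ.+ L))  ≡⟨ rearrange n L ⟩
  12 * (n * L)                                ∎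
  where
  open ℕₚ.≤-Reasoning
  rearrange : ∀ n L → (n ℕ.+ (n ℕ.+ n)) * (L ℕ.+ L ℕ.+ (L ℕ.+ L)) ≡ 12 * (n * L)
  rearrange = solve-∀

theorem1 : ∃[ c ] (0 < c × (∀ (n : ℕ) → 2 ≤ n → (G : Graph n) →
    ∃[ m ] (m ≤ c * (n * ⌊log₂ n ⌋) × SamePartition G m)))
theorem1 = 12 , ℕ.s≤s ℕ.z≤n , bound
  where
  bound : ∀ (n : ℕ) → 2 ≤ n → (G : Graph n) → ∃[ m ] (m ≤ 12 * (n * ⌊log₂ n ⌋) × SamePartition G m)
  -- Only finitely many `m` are in question and each is decidable, so the existence of `m` may be
  -- proved by contradiction.
  bound n@(ℕ.suc _) 2≤n G = decidable-stable
    (map′ (λ (m , m<N , same) → m , ℕₚ.≤-pred m<N , same) (λ (m , m≤N , same) → m , ℕ.s≤s m≤N , same)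
      (ℕₚ.anyUpTo? samePartition? (ℕ.suc (12 * (n * ⌊log₂ n ⌋)))))
    λ unstable → eventually-closed invariant-filtration (ℕ.suc ⌊log₂ n ⌋ ℕ.+ ℕ.suc ⌊log₂ n ⌋)
      (n*n≤2^[1+⌊log₂n⌋+1+⌊log₂n⌋] n)
      λ i i≤2n closed → unstable (_
        , rounds-bound n ⌊log₂ n ⌋ i (ℕ.s≤s ℕ.z≤n) (1≤⌊log₂n⌋ 2≤n) i≤2n
        , closed⇒stable _ closed)
    where open Colors G
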